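{- Let $t > 0$ be an integer and let $\varepsilon > 0$. Then there exists $n_0$ such that the following holds for all $n \ge n_0$. If $G$ is a graph on $n$ vertices equipped with a proper edge coloring and the average degree of $G$ is at least $(\log n)^{2+\varepsilon}$, then $G$ contains a rainbow subdivision of the complete graph $K_t$, i.e. a subgraph which is a $\mathsf{T}K_t$ all of whose edges have pairwise distinct colors.
   Context: All logarithms are base $2$. A subdivision $\mathsf{T}K_t$ of $K_t$ is a graph obtained from $K_t$ by replacing each edge by a path, these paths being internally vertex-disjoint. A proper edge coloring assigns colors to edges so that edges sharing a vertex get different colors. A subgraph is rainbow if all its edges have distinct colors. The paper states the hypothesis as "average degree at least $(\log n)^{2+o(1)}$"; this is made precise above as: for every fixed $\varepsilon>0$ and all sufficiently large $n$, average degree at least $(\log n)^{2+\varepsilon}$ suffices. -}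

module Defs where

open import Data.Nat using (ℕ; zero; suc; _+_; _*_; _^_; _<_; _≤_)
open import Data.Bool using (Bool; true; false; if_then_else_)
open import Data.Fin using (Fin) renaming (zero to fzero; suc to fsuc; _<_ to _<ᶠ_)
open import Data.Unit using (⊤)
open import Data.List using (List; []; _∷_; _++_; [_]; zipWith; drop)
open import Data.List.Membership.Propositional using (_∈_)
open import Data.List.Relation.Unary.Unique.Propositional using (Unique)
open import Data.List.Relation.Unary.AllPairs using (AllPairs)
open import Data.List.Relation.Unary.All using (All)
open import Data.Product using (_×_; Σ; ∃-syntax)
open import Data.Empty using (⊥)
open import Function.Definitions using (Injective)
open import Relation.Binary.PropositionalEquality using (_≡_; _≢_)
open import Relation.Nullary using (¬_)

record SimpleGraph (n : ℕ) : Set where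
  field
    adj    : Fin n → Fin n → Bool
    sym    : ∀ u v → adj u v ≡ adj v u
    irrefl : ∀ u → adj u u ≡ false
open SimpleGraph public

Edge : ∀ {n} → SimpleGraph n → Fin n → Fin n → Set
Edge G u v = adj G u v ≡ true

record EdgeColouring {n : ℕ} (G : SimpleGraph n) : Set where
  field
    col    : Fin n → Fin n → ℕ
    colSym : ∀ u v → Edge G u v → col u v ≡ col v u
open EdgeColouring public

Proper : ∀ {n} {G : SimpleGraph n} → EdgeColouring G → Set
Proper {n} {G} c = ∀ (u v w : Fin n) → Edge G u v → Edge G u w → v ≢ w → col c u v ≢ col c u w

sumFin : (n : ℕ) → (Fin n → ℕ) → ℕ
sumFin zero    f = 0
sumFin (suc n) f = f fzero + sumFin n (λ i → f (fsuc i))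

degree : ∀ {n} → SimpleGraph n → Fin n → ℕ
degree {n} G u = sumFin n (λ v → if adj G u v then 1 else 0)

degSum : ∀ {n} → SimpleGraph n → ℕ
degSum {n} G = sumFin n (degree G)

AvgDegAtLeastLogPow : ∀ {n} → SimpleGraph n → ℕ → ℕ → Set
AvgDegAtLeastLogPow {n} G p q =
  ∀ (u v : ℕ) → 0 < v →
    v ^ (2 * q + p) * degSum G ^ q < u ^ (2 * q + p) * n ^ q →
    n ^ v < 2 ^ u

walkColours : ∀ {n} {G : SimpleGraph n} → EdgeColouring G → List (Fin n) → List ℕ
walkColours c []           = []
walkColours c (x ∷ [])     = []
walkColours c (x ∷ y ∷ xs) = col c x y ∷ walkColours c (y ∷ xs)

IsWalk : ∀ {n} → SimpleGraph n → List (Fin n) → Set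
IsWalk G []           = ⊤
IsWalk G (x ∷ [])     = ⊤
IsWalk G (x ∷ y ∷ xs) = Edge G x y × IsWalk G (y ∷ xs)

Disjoint : {A : Set} → List A → List A → Set
Disjoint xs ys = ∀ {x} → x ∈ xs → x ∈ ys → ⊥

record RainbowTK {n : ℕ} (G : SimpleGraph n) (c : EdgeColouring G) (t : ℕ) : Set where
  field
    branch     : Fin t → Fin n
    branchInj  : Injective _≡_ _≡_ branch
    internal   : Fin t → Fin t → List (Fin n)
  path : Fin t → Fin t → List (Fin n)
  path i j = branch i ∷ internal i j ++ [ branch j ]
  field
    isWalk     : ∀ i j → i <ᶠ j → IsWalk G (path i j)
    intUnique  : ∀ i j → i <ᶠ j → Unique (internal i j)
    intNotBr   : ∀ i j → i <ᶠ j → ∀ k → ¬ (branch k ∈ internal i j)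
    intDisj    : ∀ i j k l → i <ᶠ j → k <ᶠ l → ¬ (i ≡ k × j ≡ l) →
                 Disjoint (internal i j) (internal k l)
    rainbowIn  : ∀ i j → i <ᶠ j → Unique (walkColours c (path i j))
    rainbowOut : ∀ i j k l → i <ᶠ j → k <ᶠ l → ¬ (i ≡ k × j ≡ l) →
                 Disjoint (walkColours c (path i j)) (walkColours c (path k l))

{-# OPTIONS --safe #-}

module Submission where

open import Defs
open import Data.Bool using (Bool; true; false; if_then_else_; _∧_; _∨_; not)
import Data.Bool.Properties as Bool
open import Data.Empty using (⊥; ⊥-elim)
open import Data.Fin using (Fin) renaming (zero to fzero; suc to fsuc; _<_ to _<ᶠ_)
import Data.Fin.Properties as Fin
open import Data.Fin.Subset.Properties using (anySubset?)
open import Data.List using (List; []; _∷_; length; _++_; [_]; _ʳ++_; upTo; allFin; tabulate; cartesianProduct)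
open import Data.List.Properties using (length-++; length-tabulate; length-upTo)
import Data.List.Membership.DecPropositional as DecMem
open import Data.List.Membership.Propositional using (_∈_; _∉_)
open import Data.List.Membership.Propositional.Properties
  using (∈-++⁺ˡ; ∈-++⁺ʳ; ∈-tabulate⁺; ∈-cartesianProduct⁺; ∈-allFin; ∈-upTo⁺)
open import Data.List.Relation.Binary.Sublist.Heterogeneous.Properties using (length-mono-≤)
open import Data.List.Relation.Binary.Sublist.Propositional as Sublist
  using (_⊆_; []; _∷_; _∷ʳ_; ⊆-refl; ⊆-trans)
open import Data.List.Relation.Binary.Sublist.Propositional.Properties using (All-resp-⊆; ++⁺ʳ)
open import Data.List.Relation.Unary.All as All using (All; []; _∷_)
open import Data.List.Relation.Unary.All.Properties using (¬Any⇒All¬)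
open import Data.List.Relation.Unary.AllPairs using ([]; _∷_)
open import Data.List.Relation.Unary.Any using (here; there)
open import Data.List.Relation.Unary.Unique.Propositional using (Unique)
open import Data.List.Relation.Unary.Unique.Propositional.Properties using (upTo⁺)
open import Data.Nat
open import Data.Nat.DivMod using (m%n<n; m*n/n≡m; m/n*n≤m; m≡m%n+[m/n]*n; /-monoˡ-≤)
open import Data.Nat.Induction using (<-rec)
open import Data.Nat.Logarithm using (⌊log₂_⌋; ⌊log₂⌋-mono-≤; ⌊log₂[2^n]⌋≡n; ⌊log₂⌊n/2⌋⌋≡⌊log₂n⌋∸1)
open import Data.Nat.Properties
open import Data.Nat.Tactic.RingSolver using (solve-∀)
open import Data.Product
open import Data.Product.Properties using (≡-dec)
open import Data.Sum using (_⊎_; inj₁; inj₂)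
open import Data.Unit using (tt)
import Data.Vec as Vec
open import Data.Vec.Properties using (lookup∘tabulate)
open import Function using (_∘_; case_of_)
open import Function.Definitions using (Injective)
open import Relation.Binary.Definitions using (DecidableEquality)
open import Relation.Binary.PropositionalEquality hiding ([_]) renaming (sym to ≡-sym)
open import Relation.Nullary
open import Relation.Nullary.Decidable using (dec-true; dec-false)

-- For sets of size about N / 2^k, a subgraph H on N vertices maximising e(H) / (|H| · (Λ + 2 log |H|)) expands by
-- a factor 1 + Ω(k / log n) even after a few colours and vertices are forbidden. Draw distinct colours at random and
-- grow from a vertex x the set S reached by rainbow trails in the drawn colours, adding new vertices in batches
-- so that a trail gains at most one edge per batch. Harmonic summation over k bounds the number of batches, hence
-- the length of the trails, by ℓ = O(log n · log log n). Every colour class is a matching, so the next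
-- draw is expected to gain at least |S| · β / K vertices (K the number of colours), and the expected number
-- of draws before |S| > N / 2 is at most 2ℓK / β. Two disjoint random sequences of K / 2 colours therefore
-- serve two vertices x and y at once, their sets meet, and erasing loops gives a rainbow x–y path.
-- Linking the branch vertices pair by pair while forbidding all used colours and vertices gives the subdivision.

-- Logarithms and harmonic sums

-- The exponent 2 comes from two factors of log n. A trail of length up to ℓ blocks up to ℓ colours
-- at its last vertex, so S must send out more than order ℓ edges per vertex. Turning the average
-- degree of H into edges leaving S costs another factor of order log n, because the weight Λ +
-- `lev` m has size log n but changes by only 1 per level. With ℓ = O(log n · log log n) the degree
-- needed is O((log n)^2 · log log n), and the double logarithm disappears in (log n)^ε. Batches
-- keep ℓ this small: if trails were extended after every draw, their length could grow with the
-- number of draws. The price is that the set U of waiting vertices does not extend trails, so edges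
-- must be counted from S to the complement of S ∪ U. This is affordable because a batch is absorbed
-- as soon as U is a noticeable fraction of S. The base weight Λ = `lev` n keeps `weight` between Λ
-- and 2Λ, so passing to H costs at most half of the average degree. Only first moments of the
-- random draws enter, and the number K of colours cancels at the end.

2*⌊n/2⌋≤n : ∀ n → 2 * ⌊ n /2⌋ ≤ n
2*⌊n/2⌋≤n zero = z≤n
2*⌊n/2⌋≤n (suc zero) = z≤n
2*⌊n/2⌋≤n (suc (suc n)) =
  subst (_≤ suc (suc n)) (≡-sym (*-suc 2 ⌊ n /2⌋)) (s≤s (s≤s (2*⌊n/2⌋≤n n)))

n<2*suc⌊n/2⌋ : ∀ n → n < 2 * suc ⌊ n /2⌋
n<2*suc⌊n/2⌋ zero = s≤s z≤n
n<2*suc⌊n/2⌋ (suc zero) = s≤s (s≤s z≤n)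
n<2*suc⌊n/2⌋ (suc (suc n)) =
  subst (suc (suc n) <_) (≡-sym (*-suc 2 (suc ⌊ n /2⌋))) (s≤s (s≤s (n<2*suc⌊n/2⌋ n)))

log₂-bounds : ∀ m → 0 < m → 2 ^ ⌊log₂ m ⌋ ≤ m × m < 2 ^ suc ⌊log₂ m ⌋
log₂-bounds = <-rec _ step
  where
  step : ∀ m → (∀ {k} → k < m → 0 < k → 2 ^ ⌊log₂ k ⌋ ≤ k × k < 2 ^ suc ⌊log₂ k ⌋) →
         0 < m → 2 ^ ⌊log₂ m ⌋ ≤ m × m < 2 ^ suc ⌊log₂ m ⌋
  step 1 rec _ rewrite ⌊log₂[2^n]⌋≡n 0 = ≤-refl , ≤-refl
  step m@(suc (suc m′)) rec _ = lo , hi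
    where
    h = ⌊ m /2⌋
    ih = rec {h} (⌊n/2⌋<n (suc m′)) (s≤s z≤n)
    l≥1 : 1 ≤ ⌊log₂ m ⌋
    l≥1 = ≤-trans (≤-reflexive (≡-sym (⌊log₂[2^n]⌋≡n 1))) (⌊log₂⌋-mono-≤ {2} {m} (s≤s (s≤s z≤n)))
    eq : suc ⌊log₂ h ⌋ ≡ ⌊log₂ m ⌋
    eq = trans (cong suc (⌊log₂⌊n/2⌋⌋≡⌊log₂n⌋∸1 m)) (m+[n∸m]≡n l≥1)
    lo = subst (λ l → 2 ^ l ≤ m) eq (≤-trans (*-monoʳ-≤ 2 (proj₁ ih)) (2*⌊n/2⌋≤n m))
    hi = subst (λ l → m < 2 ^ suc l) eq
           (<-≤-trans (n<2*suc⌊n/2⌋ m) (*-monoʳ-≤ 2 (proj₂ ih)))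

2^k≤m⇒k≤log₂m : ∀ {k m} → 2 ^ k ≤ m → k ≤ ⌊log₂ m ⌋
2^k≤m⇒k≤log₂m {k} p = subst (_≤ _) (⌊log₂[2^n]⌋≡n k) (⌊log₂⌋-mono-≤ p)

m<2^k⇒log₂m<k : ∀ {k m} → 0 < m → m < 2 ^ k → ⌊log₂ m ⌋ < k
m<2^k⇒log₂m<k {k} {m} 0<m p with ⌊log₂ m ⌋ <? k
... | yes q = q
... | no ¬q = contradiction (≤-trans (^-monoʳ-≤ 2 (≮⇒≥ ¬q)) (proj₁ (log₂-bounds m 0<m))) (<⇒≱ p)

-- Counting half-levels (⌊log₂ m²⌋ rather than ⌊log₂ m⌋) ensures that being within one
-- level of N already means exceeding N/2.
lev : ℕ → ℕ
lev m = ⌊log₂ (m * m) ⌋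

lev-mono : ∀ {a b} → a ≤ b → lev a ≤ lev b
lev-mono p = ⌊log₂⌋-mono-≤ (*-mono-≤ p p)

0<m*m : ∀ {m} → 0 < m → 0 < m * m
0<m*m p = *-mono-< p p

lev-near-top : ∀ {N s} → 0 < N → 0 < s → lev N ≤ suc (lev s) → N < 2 * s
lev-near-top {N} {s} 0<N 0<s p with N <? 2 * s
... | yes q = q
... | no ¬q = contradiction N²< (≤⇒≯ (≤-trans (≤-reflexive eq) (*-mono-≤ (≮⇒≥ ¬q) (≮⇒≥ ¬q))))
  where
  eq : 4 * (s * s) ≡ (2 * s) * (2 * s)
  eq = lem s
    where
    lem : ∀ s → 4 * (s * s) ≡ (2 * s) * (2 * s)
    lem = solve-∀
  N²< : N * N < 4 * (s * s)
  N²< = begin-strict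
    N * N                  <⟨ proj₂ (log₂-bounds (N * N) (0<m*m 0<N)) ⟩
    2 ^ suc (lev N)        ≤⟨ ^-monoʳ-≤ 2 (s≤s p) ⟩
    2 * (2 * 2 ^ lev s)    ≡⟨ ≡-sym (*-assoc 2 2 (2 ^ lev s)) ⟩
    4 * 2 ^ lev s          ≤⟨ *-monoʳ-≤ 4 (proj₁ (log₂-bounds (s * s) (0<m*m 0<s))) ⟩
    4 * (s * s)            ∎
    where open ≤-Reasoning

lev-same⇒<2* : ∀ {a b} → 0 < a → 0 < b → lev a ≡ lev b → a < 2 * b
lev-same⇒<2* 0<a 0<b eq = lev-near-top 0<a 0<b (≤-trans (≤-reflexive eq) (n≤1+n _))

-- A half-level is a factor √2, and (5/4)² = 25/16 is less than 2. The ratio 5/4 is what a batch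
-- that is not yet `Big` allows.
lev-step : ∀ {s s′} → 0 < s → s ≤ s′ → 4 * s′ ≤ 5 * s → lev s′ ≤ suc (lev s)
lev-step {s} {s′} 0<s s≤s′ p = s≤s⁻¹ (m<2^k⇒log₂m<k (0<m*m (≤-trans 0<s s≤s′)) (*-cancelˡ-< 16 _ _ bound))
  where
  open ≤-Reasoning
  e1 : ∀ a → 16 * (a * a) ≡ (4 * a) * (4 * a)
  e1 = solve-∀
  e2 : ∀ a → (5 * a) * (5 * a) ≡ 25 * (a * a)
  e2 = solve-∀
  e3 : ∀ a → 16 * (2 * a) ≡ 32 * a
  e3 = solve-∀
  bound : 16 * (s′ * s′) < 16 * 2 ^ (2 + lev s)
  bound = begin-strict
    16 * (s′ * s′)              ≡⟨ e1 s′ ⟩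
    (4 * s′) * (4 * s′)         ≤⟨ *-mono-≤ p p ⟩
    (5 * s) * (5 * s)           ≡⟨ e2 s ⟩
    25 * (s * s)                ≤⟨ *-monoˡ-≤ (s * s) (m≤m+n 25 7) ⟩
    32 * (s * s)                <⟨ *-monoʳ-< 32 (proj₂ (log₂-bounds (s * s) (0<m*m 0<s))) ⟩
    32 * 2 ^ suc (lev s)        ≡⟨ ≡-sym (e3 (2 ^ suc (lev s))) ⟩
    16 * 2 ^ (2 + lev s)        ∎

lev≤ : ∀ n → 0 < n → lev n ≤ 2 * ⌊log₂ n ⌋ + 1
lev≤ n 0<n = s≤s⁻¹ (m<2^k⇒log₂m<k (0<m*m 0<n) (<-≤-trans (*-mono-< hi hi) (≤-reflexive eq)))
  where
  l = ⌊log₂ n ⌋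
  hi = proj₂ (log₂-bounds n 0<n)
  eq : 2 ^ suc l * 2 ^ suc l ≡ 2 ^ suc (2 * l + 1)
  eq = trans (≡-sym (^-distribˡ-+-* 2 (suc l) (suc l))) (cong (2 ^_) (lem l))
    where
    lem : ∀ l → suc l + suc l ≡ suc (2 * l + 1)
    lem = solve-∀

-- A budget of batches: i levels below the top, a batch enlarges the set by a fraction at least i /
-- M, so M / i batches can be spent inside that level. The `+ 1` pays for the batch that leaves it.
harmonic : ℕ → ℕ → ℕ
harmonic M zero = 0
harmonic M (suc k) = harmonic M k + (M / suc k + 1)

harmonic-mono : ∀ M {j k} → j ≤ k → harmonic M j ≤ harmonic M k
harmonic-mono M {j} {zero} z≤n = z≤n
harmonic-mono M {j} {suc k} p with m≤n⇒m<n∨m≡n p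
... | inj₁ (s≤s q) = ≤-trans (harmonic-mono M q) (m≤m+n _ _)
... | inj₂ refl = ≤-refl

M/i≤⇒ : ∀ {M i j} .{{_ : NonZero i}} .{{_ : NonZero j}} → j ≤ i → j * (M / i) ≤ M
M/i≤⇒ {M} {i} {j} j≤i = begin
  j * (M / i)  ≤⟨ *-monoˡ-≤ (M / i) j≤i ⟩
  i * (M / i)  ≡⟨ *-comm i (M / i) ⟩
  M / i * i    ≤⟨ m/n*n≤m M i ⟩
  M            ∎
  where open ≤-Reasoning

-- Each of the r terms after the first a has quotient at most M / (a + 1). With r = a + 1 this is a
-- dyadic block, whose quotients add up to at most M.
harmonic-block : ∀ M a r → suc a * harmonic M (a + r) ≤ suc a * (harmonic M a + r) + r * M
harmonic-block M a zero rewrite +-identityʳ a | +-identityʳ (harmonic M a) = m≤m+n _ _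
harmonic-block M a (suc r) rewrite +-suc a r = begin
  suc a * (harmonic M (a + r) + (M / suc (a + r) + 1))
    ≡⟨ d1 (suc a) (harmonic M (a + r)) (M / suc (a + r)) ⟩
  suc a * harmonic M (a + r) + (suc a * (M / suc (a + r)) + suc a)
    ≤⟨ +-mono-≤ (harmonic-block M a r) (+-monoˡ-≤ (suc a) (M/i≤⇒ {M} (s≤s (m≤m+n a r)))) ⟩
  suc a * (harmonic M a + r) + r * M + (M + suc a)
    ≡⟨ d2 (suc a) (harmonic M a) r M ⟩
  suc a * (harmonic M a + suc r) + suc r * M ∎
  where
  open ≤-Reasoning
  d1 : ∀ a h m → a * (h + (m + 1)) ≡ a * h + (a * m + a)
  d1 = solve-∀
  d2 : ∀ a h r m → a * (h + r) + r * m + (m + a) ≡ a * (h + suc r) + suc r * m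
  d2 = solve-∀

harmonic-2^ : ∀ M m → harmonic M (2 ^ m ∸ 1) ≤ m * M + (2 ^ m ∸ 1)
harmonic-2^ M zero = z≤n
harmonic-2^ M (suc m) = *-cancelˡ-≤ (suc a) (begin
  suc a * harmonic M (2 ^ suc m ∸ 1)   ≡⟨ cong (λ z → suc a * harmonic M z) top ⟩
  suc a * harmonic M (a + suc a)       ≤⟨ harmonic-block M a (suc a) ⟩
  suc a * (harmonic M a + suc a) + suc a * M ≡⟨ ≡-sym (*-distribˡ-+ (suc a) (harmonic M a + suc a) M) ⟩
  suc a * (harmonic M a + suc a + M)   ≤⟨ *-monoʳ-≤ (suc a) (+-monoˡ-≤ M (+-monoˡ-≤ (suc a) (harmonic-2^ M m))) ⟩
  suc a * (m * M + a + suc a + M)      ≡⟨ cong (suc a *_) (lem m M a) ⟩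
  suc a * (suc m * M + (a + suc a))    ≡⟨ cong (λ z → suc a * (suc m * M + z)) (≡-sym top) ⟩
  suc a * (suc m * M + (2 ^ suc m ∸ 1)) ∎)
  where
  open ≤-Reasoning
  a = 2 ^ m ∸ 1
  sa : suc a ≡ 2 ^ m
  sa = m+[n∸m]≡n (m^n>0 2 m)
  top : 2 ^ suc m ∸ 1 ≡ a + suc a
  top = trans (cong (λ z → 2 * z ∸ 1) (≡-sym sa)) (cong (a +_) (+-identityʳ (suc a)))
  lem : ∀ m M a → m * M + a + suc a + M ≡ suc m * M + (a + suc a)
  lem = solve-∀

harmonic≤ : ∀ M k → 0 < k → harmonic M k ≤ suc ⌊log₂ k ⌋ * M + 2 * k
harmonic≤ M k 0<k = begin
  harmonic M k                      ≤⟨ harmonic-mono M (m<n⇒m≤n∸1 hi) ⟩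
  harmonic M (2 ^ suc l ∸ 1)        ≤⟨ harmonic-2^ M (suc l) ⟩
  suc l * M + (2 ^ suc l ∸ 1)       ≤⟨ +-monoʳ-≤ (suc l * M) (≤-trans (m∸n≤m _ 1) (*-monoʳ-≤ 2 (proj₁ (log₂-bounds k 0<k)))) ⟩
  suc l * M + 2 * k                 ∎
  where
  open ≤-Reasoning
  l = ⌊log₂ k ⌋
  hi = proj₂ (log₂-bounds k 0<k)
  m<n⇒m≤n∸1 : ∀ {m n} → m < n → m ≤ n ∸ 1
  m<n⇒m≤n∸1 (s≤s p) = p

-- At j = 3B it follows from B ≤ 2^B and 3B + 1 ≤ 4^B; afterwards each step doubles the right side
-- and at most doubles the left.
linear≤2^ : ∀ B j → 3 * B ≤ j → B * suc j ≤ 2 ^ j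
linear≤2^ B j p = subst (λ j → B * suc j ≤ 2 ^ j) (m+[n∸m]≡n p) (go (j ∸ 3 * B))
  where
  open ≤-Reasoning
  n≤2^n : ∀ n → n ≤ 2 ^ n
  n≤2^n zero = z≤n
  n≤2^n (suc n) = ≤-trans (+-mono-≤ (m^n>0 2 n) (n≤2^n n)) (≤-reflexive (cong (2 ^ n +_) (≡-sym (+-identityʳ _))))
  4^ : ∀ n → suc (3 * n) ≤ 2 ^ (2 * n)
  4^ zero = ≤-refl
  4^ (suc n) = begin
    suc (3 * suc n)       ≤⟨ ≤-trans (m≤m+n _ (9 * n)) (≤-reflexive (e n)) ⟩
    4 * suc (3 * n)       ≤⟨ *-monoʳ-≤ 4 (4^ n) ⟩
    4 * 2 ^ (2 * n)       ≡⟨ ≡-sym (^-distribˡ-+-* 2 2 (2 * n)) ⟩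
    2 ^ (2 + 2 * n)       ≡⟨ cong (2 ^_) (≡-sym (*-suc 2 n)) ⟩
    2 ^ (2 * suc n)       ∎
    where
    e : ∀ n → suc (3 * suc n) + 9 * n ≡ 4 * suc (3 * n)
    e = solve-∀
  go : ∀ i → B * suc (3 * B + i) ≤ 2 ^ (3 * B + i)
  go zero rewrite +-identityʳ (3 * B) = begin
    B * suc (3 * B)       ≤⟨ *-mono-≤ (n≤2^n B) (4^ B) ⟩
    2 ^ B * 2 ^ (2 * B)   ≡⟨ ≡-sym (^-distribˡ-+-* 2 B (2 * B)) ⟩
    2 ^ (3 * B)           ∎
  go (suc i) rewrite +-suc (3 * B) i = begin
    B * suc (suc (3 * B + i))  ≤⟨ *-monoʳ-≤ B (≤-trans (m≤m+n _ (3 * B + i)) (≤-reflexive (e (3 * B + i)))) ⟩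
    B * (2 * suc (3 * B + i))  ≡⟨ e′ B (suc (3 * B + i)) ⟩
    2 * (B * suc (3 * B + i))  ≤⟨ *-monoʳ-≤ 2 (go i) ⟩
    2 * 2 ^ (3 * B + i)        ∎
    where
    e : ∀ n → suc (suc n) + n ≡ 2 * suc n
    e = solve-∀
    e′ : ∀ a b → a * (2 * b) ≡ 2 * (a * b)
    e′ = solve-∀

-- Applied with m = log log n, this absorbs the double-logarithmic factor, raised to the power q,
-- into a single factor log n. The quotient j = m / q replaces a q-th root.
linear^≤2^ : ∀ C q m → .{{_ : NonZero q}} → 3 * (C * (4 + q)) * q ≤ m → (C * (m + 4)) ^ q ≤ 2 ^ m
linear^≤2^ C q m p = begin
  (C * (m + 4)) ^ q      ≤⟨ ^-monoˡ-≤ q small ⟩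
  (2 ^ j) ^ q            ≡⟨ ^-*-assoc 2 j q ⟩
  2 ^ (j * q)            ≤⟨ ^-monoʳ-≤ 2 (m/n*n≤m m q) ⟩
  2 ^ m                  ∎
  where
  open ≤-Reasoning
  j = m / q
  j≥ : 3 * (C * (4 + q)) ≤ j
  j≥ = subst (_≤ j) (m*n/n≡m (3 * (C * (4 + q))) q) (/-monoˡ-≤ q p)
  m≤ : m ≤ q * suc j
  m≤ = begin
    m              ≡⟨ m≡m%n+[m/n]*n m q ⟩
    m % q + j * q  ≤⟨ +-monoˡ-≤ (j * q) (<⇒≤ (m%n<n m q)) ⟩
    q + j * q      ≡⟨ *-comm (suc j) q ⟩
    q * suc j      ∎
  e : ∀ C q j → C * ((4 + q) * j) ≡ C * (4 + q) * j
  e = solve-∀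
  e′ : ∀ q j → q * suc j + 4 + 4 * j ≡ (4 + q) * suc j
  e′ = solve-∀
  small : C * (m + 4) ≤ 2 ^ j
  small = begin
    C * (m + 4)              ≤⟨ *-monoʳ-≤ C (≤-trans (+-monoˡ-≤ 4 m≤) (≤-trans (m≤m+n _ (4 * j)) (≤-reflexive (e′ q j)))) ⟩
    C * ((4 + q) * suc j)    ≡⟨ e C q (suc j) ⟩
    C * (4 + q) * suc j      ≤⟨ linear≤2^ (C * (4 + q)) j j≥ ⟩
    2 ^ j                    ∎

^-distribʳ-* : ∀ k m n → (m * n) ^ k ≡ m ^ k * n ^ k
^-distribʳ-* zero m n = refl
^-distribʳ-* (suc k) m n = trans (cong (m * n *_) (^-distribʳ-* k m n)) (lem m n (m ^ k) (n ^ k))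
  where
  lem : ∀ a b c d → a * b * (c * d) ≡ a * c * (b * d)
  lem = solve-∀

-- Sums over finite sets

private variable
  n : ℕ
  A : Set

∑ : (Fin n → ℕ) → ℕ
∑ {n} f = sumFin n f

∑-mono : {f g : Fin n → ℕ} → (∀ i → f i ≤ g i) → ∑ f ≤ ∑ g
∑-mono {zero} p = z≤n
∑-mono {suc n} p = +-mono-≤ (p fzero) (∑-mono (λ i → p (fsuc i)))

∑-cong : {f g : Fin n → ℕ} → (∀ i → f i ≡ g i) → ∑ f ≡ ∑ g
∑-cong {zero} p = refl
∑-cong {suc n} p = cong₂ _+_ (p fzero) (∑-cong (λ i → p (fsuc i)))

+-interchange : ∀ a b c d → (a + b) + (c + d) ≡ (a + c) + (b + d)
+-interchange = solve-∀

∑-+ : (f g : Fin n → ℕ) → ∑ (λ i → f i + g i) ≡ ∑ f + ∑ g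
∑-+ {zero} f g = refl
∑-+ {suc n} f g = trans (cong (f fzero + g fzero +_) (∑-+ (λ i → f (fsuc i)) (λ i → g (fsuc i))))
                        (+-interchange (f fzero) _ _ _)

∑-*ˡ : ∀ a (f : Fin n → ℕ) → ∑ (λ i → a * f i) ≡ a * ∑ f
∑-*ˡ {zero} a f = ≡-sym (*-zeroʳ a)
∑-*ˡ {suc n} a f = trans (cong (a * f fzero +_) (∑-*ˡ a (λ i → f (fsuc i))))
                         (≡-sym (*-distribˡ-+ a (f fzero) _))

∑-*ʳ : ∀ (f : Fin n → ℕ) a → ∑ (λ i → f i * a) ≡ ∑ f * a
∑-*ʳ f a = trans (∑-cong (λ i → *-comm (f i) a)) (trans (∑-*ˡ a f) (*-comm a (∑ f)))

∑-zero : ∑ {n} (λ _ → 0) ≡ 0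
∑-zero {zero} = refl
∑-zero {suc n} = ∑-zero {n}

∑-const : ∀ k → ∑ {n} (λ _ → k) ≡ n * k
∑-const {zero} k = refl
∑-const {suc n} k = cong (k +_) (∑-const {n} k)

∑-swap : ∀ {m} (f : Fin n → Fin m → ℕ) → ∑ (λ i → ∑ (f i)) ≡ ∑ (λ j → ∑ (λ i → f i j))
∑-swap {zero} {m} f = ≡-sym (∑-zero {m})
∑-swap {suc n} f = trans (cong (∑ (f fzero) +_) (∑-swap (λ i → f (fsuc i))))
                         (≡-sym (∑-+ (f fzero) _))

≤∑ : ∀ (f : Fin n → ℕ) i → f i ≤ ∑ f
≤∑ f fzero = m≤m+n _ _
≤∑ f (fsuc i) = ≤-trans (≤∑ (λ j → f (fsuc j)) i) (m≤n+m _ _)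

ι : Bool → ℕ
ι b = if b then 1 else 0

ι≤1 : ∀ b → ι b ≤ 1
ι≤1 true = ≤-refl
ι≤1 false = z≤n

ι≤ : ∀ {b k} → (b ≡ true → 1 ≤ k) → ι b ≤ k
ι≤ {true} h = h refl
ι≤ {false} h = z≤n

∧⁻ : ∀ {a b} → a ∧ b ≡ true → a ≡ true × b ≡ true
∧⁻ {true} p = refl , p

∨⁻ : ∀ {a b} → a ∨ b ≡ true → a ≡ true ⊎ b ≡ true
∨⁻ {true} p = inj₁ refl
∨⁻ {false} p = inj₂ p

not⁻ : ∀ {a} → not a ≡ true → ¬ (a ≡ true)
not⁻ {true} () _
not⁻ {false} _ ()

private variable
  P Q : Set

χ : Dec P → ℕ
χ d = ι (does d)

does⁺ : (d : Dec P) → P → does d ≡ true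
does⁺ d p = dec-true d p

does⁻ : (d : Dec P) → does d ≡ true → P
does⁻ (yes p) _ = p

χ-yes : (d : Dec P) → P → χ d ≡ 1
χ-yes d p = cong ι (does⁺ d p)

χ-no : (d : Dec P) → ¬ P → χ d ≡ 0
χ-no d p = cong ι (dec-false d p)

χ≤ : ∀ (d : Dec P) {k} → (P → 1 ≤ k) → χ d ≤ k
χ≤ (yes p) h = h p
χ≤ (no _) h = z≤n

1≤χ : (d : Dec P) → P → 1 ≤ χ d
1≤χ d p = ≤-reflexive (≡-sym (χ-yes d p))

∑-χ≤1 : {P : Fin n → Set} (P? : ∀ i → Dec (P i)) → (∀ {i j} → P i → P j → i ≡ j) → ∑ (λ i → χ (P? i)) ≤ 1
∑-χ≤1 {zero} P? uniq = z≤n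
∑-χ≤1 {suc n} P? uniq with P? fzero
... | no _ = ∑-χ≤1 (λ i → P? (fsuc i)) (λ p q → Fin.suc-injective (uniq p q))
... | yes p = s≤s (≤-trans (∑-mono (λ i → ≤-reflexive (χ-no (P? (fsuc i)) (λ q → case (uniq p q) of λ ()))))
                           (≤-reflexive (∑-zero {n})))

∑-χ≤χ∃ : {P : Fin n → Set} (P? : ∀ i → Dec (P i)) (e : Dec Q) → (∀ {i j} → P i → P j → i ≡ j) →
         (∀ i → P i → Q) → ∑ (λ i → χ (P? i)) ≤ χ e
∑-χ≤χ∃ P? (yes _) uniq h = ∑-χ≤1 P? uniq
∑-χ≤χ∃ {n} P? (no ¬q) uniq h =
  ≤-trans (∑-mono (λ i → ≤-reflexive (χ-no (P? i) (λ p → ¬q (h i p))))) (≤-reflexive (∑-zero {n}))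

module _ (_≟A_ : DecidableEquality A) where
  open DecMem _≟A_ using (_∈?_)

  -- Used to count what a forbidden list destroys at one vertex: f is the colour of an edge there,
  -- injective by properness, or the neighbour itself.
  ∑-χ∈≤length : {P : Fin n → Set} (P? : ∀ i → Dec (P i)) (f : Fin n → A) →
    (∀ {i j} → P i → P j → f i ≡ f j → i ≡ j) →
    ∀ L → ∑ (λ i → χ (P? i ×-dec (f i ∈? L))) ≤ length L
  ∑-χ∈≤length {n} P? f inj [] =
    ≤-trans (∑-mono (λ i → ≤-reflexive (χ-no (P? i ×-dec (f i ∈? [])) (λ where (_ , ()))))) (≤-reflexive (∑-zero {n}))
  ∑-χ∈≤length P? f inj (a ∷ L) = begin
    ∑ (λ i → χ (P? i ×-dec (f i ∈? (a ∷ L))))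
      ≤⟨ ∑-mono (λ i → χ≤ (P? i ×-dec (f i ∈? (a ∷ L))) (split i)) ⟩
    ∑ (λ i → χ (P? i ×-dec (f i ≟A a)) + χ (P? i ×-dec (f i ∈? L)))
      ≡⟨ ∑-+ (λ i → χ (P? i ×-dec (f i ≟A a))) _ ⟩
    ∑ (λ i → χ (P? i ×-dec (f i ≟A a))) + ∑ (λ i → χ (P? i ×-dec (f i ∈? L)))
      ≤⟨ +-mono-≤ (∑-χ≤1 (λ i → P? i ×-dec (f i ≟A a)) (λ (p , e) (q , e′) → inj p q (trans e (≡-sym e′))))
                  (∑-χ∈≤length P? f inj L) ⟩
    suc (length L) ∎
    where
    open ≤-Reasoning
    split : ∀ i → _ → 1 ≤ χ (P? i ×-dec (f i ≟A a)) + χ (P? i ×-dec (f i ∈? L))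
    split i (p , here e) = ≤-trans (1≤χ (P? i ×-dec (f i ≟A a)) (p , e)) (m≤m+n _ _)
    split i (p , there m) = ≤-trans (1≤χ (P? i ×-dec (f i ∈? L)) (p , m)) (m≤n+m _ _)

-- Vertex sets as Boolean predicates

VSet : ℕ → Set
VSet n = Fin n → Bool

∣_∣ : VSet n → ℕ
∣ X ∣ = ∑ (λ v → ι (X v))

_⊑_ : VSet n → VSet n → Set
X ⊑ Y = ∀ v → X v ≡ true → Y v ≡ true

_∪ˢ_ : VSet n → VSet n → VSet n
(X ∪ˢ Y) v = X v ∨ Y v

_∖ˢ_ : VSet n → VSet n → VSet n
(X ∖ˢ Y) v = X v ∧ not (Y v)

is? : (X : VSet n) (v : Fin n) → Dec (X v ≡ true)
is? X v = X v Bool.≟ true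

χ-is : (X : VSet n) (v : Fin n) → χ (is? X v) ≡ ι (X v)
χ-is X v with X v
... | true = refl
... | false = refl

ι-mono : ∀ {a b} → (a ≡ true → b ≡ true) → ι a ≤ ι b
ι-mono {true} h = ≤-reflexive (cong ι (≡-sym (h refl)))
ι-mono {false} h = z≤n

⊑⇒∣∣≤ : {X Y : VSet n} → X ⊑ Y → ∣ X ∣ ≤ ∣ Y ∣
⊑⇒∣∣≤ h = ∑-mono (λ v → ι-mono (h v))

∣∪∣-disjoint : (X Y : VSet n) → (∀ v → X v ≡ true → Y v ≡ true → Data.Empty.⊥) → ∣ X ∪ˢ Y ∣ ≡ ∣ X ∣ + ∣ Y ∣
∣∪∣-disjoint X Y dis = trans (∑-cong eq) (∑-+ (λ v → ι (X v)) (λ v → ι (Y v)))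
  where
  eq : ∀ v → ι (X v ∨ Y v) ≡ ι (X v) + ι (Y v)
  eq v with X v in ex | Y v in ey
  ... | true | true = ⊥-elim (dis v ex ey)
  ... | true | false = refl
  ... | false | _ = refl

∣∖∣ : (X Y : VSet n) → Y ⊑ X → ∣ X ∖ˢ Y ∣ + ∣ Y ∣ ≡ ∣ X ∣
∣∖∣ X Y sub = trans (≡-sym (∑-+ (λ v → ι (X v ∧ not (Y v))) (λ v → ι (Y v)))) (∑-cong eq)
  where
  eq : ∀ v → ι (X v ∧ not (Y v)) + ι (Y v) ≡ ι (X v)
  eq v with X v in ex | Y v in ey
  ... | true | true = refl
  ... | true | false = refl
  ... | false | true = case trans (≡-sym ex) (sub v ey) of λ ()
  ... | false | false = refl

meet : {X Y H : VSet n} → X ⊑ H → Y ⊑ H → ∣ H ∣ < ∣ X ∣ + ∣ Y ∣ → ∃[ v ] (X v ≡ true × Y v ≡ true)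
meet {n} {X} {Y} {H} xh yh lt with Fin.any? (λ v → is? X v ×-dec is? Y v)
... | yes r = r
... | no none = contradiction
  (≤-trans (≤-reflexive (≡-sym (∣∪∣-disjoint X Y (λ v a b → none (v , a , b)))))
           (⊑⇒∣∣≤ sub))
  (<⇒≱ lt)
  where
  sub : (X ∪ˢ Y) ⊑ H
  sub v e with X v in ex
  ... | true = xh v ex
  ... | false = yh v e

1≤∣∣ : {X : VSet n} → ∀ {v} → X v ≡ true → 1 ≤ ∣ X ∣
1≤∣∣ {X = X} {v} e = ≤-trans (≤-reflexive (cong ι (≡-sym e))) (≤∑ (λ w → ι (X w)) v)

choose : ∀ t (X : VSet n) → t ≤ ∣ X ∣ →
  Σ[ f ∈ (Fin t → Fin n) ] ((∀ i → X (f i) ≡ true) × (∀ {i j} → f i ≡ f j → i ≡ j))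
choose zero X _ = (λ ()) , (λ ()) , λ { {()} }
choose {n} (suc t) X p with Fin.any? (is? X)
... | no none = contradiction p (<⇒≱ (s≤s (≤-trans (≤-reflexive empty) z≤n)))
  where
  empty : ∣ X ∣ ≡ 0
  empty = trans (∑-cong (λ v → cong ι (Bool.¬-not (λ e → none (v , e))))) (∑-zero {n})
... | yes (v , Xv) = f , fX , finj
  where
  Y : VSet _
  Y w = does (is? X w ×-dec ¬? (w Fin.≟ v))
  Y⁻ : ∀ w → Y w ≡ true → X w ≡ true × w ≢ v
  Y⁻ w = does⁻ (is? X w ×-dec ¬? (w Fin.≟ v))
  bound : ∣ X ∣ ≤ ∣ Y ∣ + 1
  bound = begin
    ∣ X ∣ ≤⟨ ∑-mono pt ⟩
    ∑ (λ w → ι (Y w) + χ (w Fin.≟ v)) ≡⟨ ∑-+ (λ w → ι (Y w)) _ ⟩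
    ∣ Y ∣ + ∑ (λ w → χ (w Fin.≟ v)) ≤⟨ +-monoʳ-≤ ∣ Y ∣ (∑-χ≤1 (Fin._≟ v) (λ e e′ → trans e (≡-sym e′))) ⟩
    ∣ Y ∣ + 1 ∎
    where
    open ≤-Reasoning
    pt : ∀ w → ι (X w) ≤ ι (Y w) + χ (w Fin.≟ v)
    pt w with w Fin.≟ v
    ... | yes _ = ≤-trans (ι≤1 (X w)) (m≤n+m _ _)
    ... | no ne with X w
    ... | true = ≤-refl
    ... | false = z≤n
  ih = choose t Y (s≤s⁻¹ (≤-trans p (≤-trans bound (≤-reflexive (+-comm _ 1)))))
  g = proj₁ ih
  f : Fin (suc t) → Fin _
  f fzero = v
  f (fsuc i) = g i
  fX : ∀ i → X (f i) ≡ true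
  fX fzero = Xv
  fX (fsuc i) = proj₁ (Y⁻ _ (proj₁ (proj₂ ih) i))
  finj : ∀ {i j} → f i ≡ f j → i ≡ j
  finj {fzero} {fzero} _ = refl
  finj {fzero} {fsuc j} e = ⊥-elim (proj₂ (Y⁻ _ (proj₁ (proj₂ ih) j)) (≡-sym e))
  finj {fsuc i} {fzero} e = ⊥-elim (proj₂ (Y⁻ _ (proj₁ (proj₂ ih) i)) e)
  finj {fsuc i} {fsuc j} e = cong fsuc (proj₂ (proj₂ ih) e)

-- Random sequences of distinct colours

private variable
  c : ℕ
  R R′ R″ cs : List ℕ

-- Drawing without replacement. The rest keeps its order, so two successive draws leave the same
-- list in whichever order they are made; `Σpick-swap` rests on this.
data Pick : List ℕ → ℕ → List ℕ → Set where
  here  : Pick (c ∷ R) c R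
  there : ∀ {d} → Pick R c R′ → Pick (d ∷ R) c (d ∷ R′)

Σpick : List ℕ → (ℕ → List ℕ → ℕ) → ℕ
Σpick []      g = 0
Σpick (c ∷ R) g = g c R + Σpick R (λ d R′ → g d (c ∷ R′))

Σpick-mono : ∀ R {g h} → (∀ {c R′} → Pick R c R′ → g c R′ ≤ h c R′) → Σpick R g ≤ Σpick R h
Σpick-mono [] p = z≤n
Σpick-mono (c ∷ R) p = +-mono-≤ (p here) (Σpick-mono R (λ q → p (there q)))

Σpick-cong : ∀ R {g h} → (∀ {c R′} → Pick R c R′ → g c R′ ≡ h c R′) → Σpick R g ≡ Σpick R h
Σpick-cong [] p = refl
Σpick-cong (c ∷ R) p = cong₂ _+_ (p here) (Σpick-cong R (λ q → p (there q)))

Σpick-+ : ∀ R g h → Σpick R (λ c R′ → g c R′ + h c R′) ≡ Σpick R g + Σpick R h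
Σpick-+ [] g h = refl
Σpick-+ (c ∷ R) g h = trans (cong (g c R + h c R +_) (Σpick-+ R _ _)) (+-interchange (g c R) _ _ _)

Σpick-*ˡ : ∀ R a g → Σpick R (λ c R′ → a * g c R′) ≡ a * Σpick R g
Σpick-*ˡ [] a g = ≡-sym (*-zeroʳ a)
Σpick-*ˡ (c ∷ R) a g = trans (cong (a * g c R +_) (Σpick-*ˡ R a _)) (≡-sym (*-distribˡ-+ a (g c R) _))

Σpick-const : ∀ R k → Σpick R (λ _ _ → k) ≡ length R * k
Σpick-const [] k = refl
Σpick-const (c ∷ R) k = cong (k +_) (Σpick-const R k)

Σpick-∑ : ∀ R (g : ℕ → Fin n → ℕ) → Σpick R (λ c _ → ∑ (g c)) ≡ ∑ (λ i → Σpick R (λ c _ → g c i))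
Σpick-∑ {n} [] g = ≡-sym (∑-zero {n})
Σpick-∑ (c ∷ R) g = trans (cong (∑ (g c) +_) (Σpick-∑ R g)) (≡-sym (∑-+ (g c) _))

Σpick-∈ : ∀ (g : ℕ → ℕ) {c} → c ∈ R → g c ≤ Σpick R (λ c _ → g c)
Σpick-∈ g (here refl) = m≤m+n _ _
Σpick-∈ g (there p) = ≤-trans (Σpick-∈ g p) (m≤n+m _ _)

Σpick-swap : ∀ R (g : ℕ → ℕ → List ℕ → ℕ) →
  Σpick R (λ c R′ → Σpick R′ (λ d R″ → g c d R″)) ≡ Σpick R (λ d R′ → Σpick R′ (λ c R″ → g c d R″))
Σpick-swap [] g = refl
Σpick-swap (x ∷ R) g = begin
  Σpick R (λ d R′ → g x d R′) + Σpick R (λ c R′ → g c x R′ + Σpick R′ (λ d R″ → g c d (x ∷ R″)))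
    ≡⟨ cong (Σpick R (λ d R′ → g x d R′) +_) (Σpick-+ R _ _) ⟩
  Σpick R (λ d R′ → g x d R′) + (Σpick R (λ c R′ → g c x R′) + Σpick R (λ c R′ → Σpick R′ (λ d R″ → g c d (x ∷ R″))))
    ≡⟨ cong (λ z → Σpick R (λ d R′ → g x d R′) + (Σpick R (λ c R′ → g c x R′) + z)) (Σpick-swap R _) ⟩
  Σpick R (λ d R′ → g x d R′) + (Σpick R (λ c R′ → g c x R′) + Σpick R (λ d R′ → Σpick R′ (λ c R″ → g c d (x ∷ R″))))
    ≡⟨ lem (Σpick R (λ d R′ → g x d R′)) (Σpick R (λ c R′ → g c x R′)) _ ⟩
  Σpick R (λ c R′ → g c x R′) + (Σpick R (λ d R′ → g x d R′) + Σpick R (λ d R′ → Σpick R′ (λ c R″ → g c d (x ∷ R″))))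
    ≡⟨ cong (Σpick R (λ c R′ → g c x R′) +_) (≡-sym (Σpick-+ R _ _)) ⟩
  Σpick R (λ c R′ → g c x R′) + Σpick R (λ d R′ → g x d R′ + Σpick R′ (λ c R″ → g c d (x ∷ R″))) ∎
  where
  open ≡-Reasoning
  lem : ∀ a b c → a + (b + c) ≡ b + (a + c)
  lem = solve-∀

Σpick-exists : ∀ R {g h} → Σpick R g < Σpick R h → ∃[ c ] ∃[ R′ ] (Pick R c R′ × g c R′ < h c R′)
Σpick-exists (c ∷ R) {g} {h} lt with g c R <? h c R
... | yes p = c , R , here , p
... | no ¬p with Σpick-exists R (+-cancelˡ-< (h c R) _ _ (≤-<-trans (+-monoˡ-≤ _ (≮⇒≥ ¬p)) lt))
... | d , R′ , q , r = d , (c ∷ R′) , there q , r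

Pick-length : Pick R c R′ → length R ≡ suc (length R′)
Pick-length here = refl
Pick-length (there p) = cong suc (Pick-length p)

Pick-split : ∀ {x} → Pick R c R′ → x ∈ R → x ≡ c ⊎ x ∈ R′
Pick-split here (here e) = inj₁ e
Pick-split here (there m) = inj₂ m
Pick-split (there p) (here e) = inj₂ (here e)
Pick-split (there p) (there m) with Pick-split p m
... | inj₁ e = inj₁ e
... | inj₂ m′ = inj₂ (there m′)

Pick-∈ : Pick R c R′ → c ∈ R
Pick-∈ here = here refl
Pick-∈ (there p) = there (Pick-∈ p)

Pick-⊆ : ∀ {x} → Pick R c R′ → x ∈ R′ → x ∈ R
Pick-⊆ here m = there m
Pick-⊆ (there p) (here e) = here e
Pick-⊆ (there p) (there m) = there (Pick-⊆ p m)

Pick-unique : Unique R → Pick R c R′ → Unique R′ × ¬ (c ∈ R′)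
Pick-unique (a ∷ u) here = u , λ m → All.lookup a m refl
Pick-unique (a ∷ u) (there p) with Pick-unique u p
... | u′ , c∉ = All.tabulate (λ m → All.lookup a (Pick-⊆ p m)) ∷ u′ , notin
  where
  notin : ¬ _
  notin (here refl) = All.lookup a (Pick-∈ p) refl
  notin (there m) = c∉ m

data Draws : List ℕ → List ℕ → List ℕ → Set where
  done : Draws R [] R
  draw : Pick R c R′ → Draws R′ cs R″ → Draws R (c ∷ cs) R″

Draws-length : Draws R cs R′ → length R ≡ length cs + length R′
Draws-length done = refl
Draws-length (draw p d) = trans (Pick-length p) (cong suc (Draws-length d))

Draws-∈ : ∀ {x} → Draws R cs R′ → x ∈ cs → x ∈ R
Draws-∈ (draw p d) (here refl) = Pick-∈ p
Draws-∈ (draw p d) (there m) = Pick-⊆ p (Draws-∈ d m)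

Draws-⊆ : ∀ {x} → Draws R cs R′ → x ∈ R′ → x ∈ R
Draws-⊆ done m = m
Draws-⊆ (draw p d) m = Pick-⊆ p (Draws-⊆ d m)

Draws-disjoint : ∀ {x} → Unique R → Draws R cs R′ → x ∈ cs → ¬ x ∈ R′
Draws-disjoint u (draw p d) (here refl) m = proj₂ (Pick-unique u p) (Draws-⊆ d m)
Draws-disjoint u (draw p d) (there i) m = Draws-disjoint (proj₁ (Pick-unique u p)) d i m

-- An expectation over T draws, not normalised: there are `falling T (length R)` outcomes, and every
-- probabilistic bound below is cleared of this denominator.
Σdraws : ℕ → List ℕ → (List ℕ → List ℕ → ℕ) → ℕ
Σdraws zero    R h = h [] R
Σdraws (suc T) R h = Σpick R (λ c R′ → Σdraws T R′ (λ cs R″ → h (c ∷ cs) R″))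

Σdraws-cong : ∀ T {R g h} → (∀ {cs R′} → length cs ≡ T → Draws R cs R′ → g cs R′ ≡ h cs R′) → Σdraws T R g ≡ Σdraws T R h
Σdraws-cong zero p = p refl done
Σdraws-cong (suc T) {R} p = Σpick-cong R (λ q → Σdraws-cong T (λ e d → p (cong suc e) (draw q d)))

Σdraws-+ : ∀ T R g h → Σdraws T R (λ cs R′ → g cs R′ + h cs R′) ≡ Σdraws T R g + Σdraws T R h
Σdraws-+ zero R g h = refl
Σdraws-+ (suc T) R g h = trans (Σpick-cong R (λ {c} {R′} _ → Σdraws-+ T R′ _ _)) (Σpick-+ R _ _)

Σdraws-*ˡ : ∀ T R a g → Σdraws T R (λ cs R′ → a * g cs R′) ≡ a * Σdraws T R g
Σdraws-*ˡ zero R a g = refl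
Σdraws-*ˡ (suc T) R a g = trans (Σpick-cong R (λ {c} {R′} _ → Σdraws-*ˡ T R′ a _)) (Σpick-*ˡ R a _)

Σdraws-exists : ∀ T R {g h} → Σdraws T R g < Σdraws T R h →
  ∃[ cs ] ∃[ R′ ] (Draws R cs R′ × length cs ≡ T × g cs R′ < h cs R′)
Σdraws-exists zero R lt = [] , R , done , refl , lt
Σdraws-exists (suc T) R lt with Σpick-exists R lt
... | c , R′ , p , lt′ with Σdraws-exists T R′ lt′
... | cs , R″ , d , e , r = c ∷ cs , R″ , draw p d , cong suc e , r

Σpick-Σdraws-swap : ∀ T R (h : ℕ → List ℕ → List ℕ → ℕ) →
  Σpick R (λ c R′ → Σdraws T R′ (λ ds R″ → h c ds R″)) ≡ Σdraws T R (λ ds R′ → Σpick R′ (λ c R″ → h c ds R″))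
Σpick-Σdraws-swap zero R h = refl
Σpick-Σdraws-swap (suc T) R h =
  trans (Σpick-swap R (λ c d R″ → Σdraws T R″ (λ ds → h c (d ∷ ds))))
        (Σpick-cong R (λ {d} {R′} _ → Σpick-Σdraws-swap T R′ (λ c ds → h c (d ∷ ds))))

-- Exchangeability: a second block of draws is distributed like a first one, so a mean bounded over
-- draws from the full palette is bounded for the second sequence too.
Σdraws-swap : ∀ S T R (h : List ℕ → List ℕ → List ℕ → ℕ) →
  Σdraws S R (λ cs R′ → Σdraws T R′ (λ ds R″ → h cs ds R″)) ≡
  Σdraws T R (λ ds R′ → Σdraws S R′ (λ cs R″ → h cs ds R″))
Σdraws-swap zero T R h = refl
Σdraws-swap (suc S) T R h =
  trans (Σpick-cong R (λ {c} {R′} _ → Σdraws-swap S T R′ (λ cs → h (c ∷ cs))))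
        (Σpick-Σdraws-swap T R (λ c ds R′ → Σdraws S R′ (λ cs R″ → h (c ∷ cs) ds R″)))

falling : ℕ → ℕ → ℕ
falling zero    r       = 1
falling (suc T) zero    = 0
falling (suc T) (suc r) = suc r * falling T r

falling>0 : ∀ {T r} → T ≤ r → 0 < falling T r
falling>0 z≤n = s≤s z≤n
falling>0 {suc T} {suc r} (s≤s p) = *-mono-< {0} {suc r} (s≤s z≤n) (falling>0 p)

Σdraws-const : ∀ T R k → Σdraws T R (λ _ _ → k) ≡ falling T (length R) * k
Σdraws-const zero R k = ≡-sym (*-identityˡ k)
Σdraws-const (suc T) [] k = refl
Σdraws-const (suc T) R@(c ∷ R₀) k = begin
  Σpick R (λ _ R′ → Σdraws T R′ (λ _ _ → k))
    ≡⟨ Σpick-cong R (λ {_} {R′} p → trans (Σdraws-const T R′ k) (cong (λ l → falling T l * k) (≡-sym (suc-injective (Pick-length p))))) ⟩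
  Σpick R (λ _ _ → falling T (length R₀) * k) ≡⟨ Σpick-const R _ ⟩
  length R * (falling T (length R₀) * k)      ≡⟨ ≡-sym (*-assoc (length R) (falling T (length R₀)) k) ⟩
  falling (suc T) (length R) * k              ∎
  where open ≡-Reasoning

-- First moment: the means of f and g are at most B / β each, so the mean of `f a + g b` is below T
-- and some outcome lies below T.
two-draws : ∀ T R (f g : List ℕ → ℕ) {β B} → length R ≡ T + T →
  β * Σdraws T R (λ cs _ → f cs) ≤ B * falling T (T + T) →
  β * Σdraws T R (λ cs _ → g cs) ≤ B * falling T (T + T) →
  2 * B < β * T →
  ∃[ a ] ∃[ b ] ∃[ R′ ] ∃[ R″ ] (Draws R a R′ × Draws R′ b R″ × length a ≡ T × length b ≡ T × f a < T × g b < T)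
two-draws T R f g {β} {B} len pf pg lt
  with Σdraws-exists T R {λ a R′ → Σdraws T R′ (λ b _ → f a + g b)} {λ a R′ → Σdraws T R′ (λ _ _ → T)} total<
  where
  open ≤-Reasoning
  t = falling T (T + T)
  t′ = falling T T
  left : ∀ {cs R′} → length cs ≡ T → Draws R cs R′ → length R′ ≡ T
  left {cs} {R′} e d = +-cancelˡ-≡ T _ _ (trans (cong (_+ length R′) (≡-sym e)) (trans (≡-sym (Draws-length d)) len))
  inner : ∀ (h : List ℕ → ℕ) → Σdraws T R (λ a R′ → Σdraws T R′ (λ _ _ → h a)) ≡ t′ * Σdraws T R (λ a _ → h a)
  inner h = trans (Σdraws-cong T (λ {cs} {R′} e d → trans (Σdraws-const T R′ (h cs)) (cong (λ l → falling T l * h cs) (left e d))))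
                  (Σdraws-*ˡ T R t′ _)
  sum≡ : Σdraws T R (λ a R′ → Σdraws T R′ (λ b _ → f a + g b)) ≡
         t′ * Σdraws T R (λ a _ → f a) + t′ * Σdraws T R (λ b _ → g b)
  sum≡ = trans (Σdraws-cong T (λ {cs} {R′} _ _ → Σdraws-+ T R′ (λ _ _ → f cs) (λ b _ → g b)))
        (trans (Σdraws-+ T R _ _)
               (cong₂ _+_ (inner f) (trans (Σdraws-swap T T R (λ _ b _ → g b)) (inner g))))
  e1 : ∀ β t a b → β * (t * a + t * b) ≡ t * (β * a + β * b)
  e1 = solve-∀
  e2 : ∀ t B u → t * (B * u + B * u) ≡ t * u * (2 * B)
  e2 = solve-∀
  e3 : ∀ t u β T → t * u * (β * T) ≡ β * (t * (u * T))
  e3 = solve-∀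
  pos : 0 < t′ * t
  pos = *-mono-< (falling>0 {T} ≤-refl) (falling>0 (m≤m+n T T))
  total< : Σdraws T R (λ a R′ → Σdraws T R′ (λ b _ → f a + g b)) < Σdraws T R (λ a R′ → Σdraws T R′ (λ _ _ → T))
  total< = *-cancelˡ-< β _ _ (begin-strict
    β * Σdraws T R (λ a R′ → Σdraws T R′ (λ b _ → f a + g b)) ≡⟨ cong (β *_) sum≡ ⟩
    β * (t′ * Σdraws T R (λ a _ → f a) + t′ * Σdraws T R (λ b _ → g b)) ≡⟨ e1 β t′ _ _ ⟩
    t′ * (β * Σdraws T R (λ a _ → f a) + β * Σdraws T R (λ b _ → g b)) ≤⟨ *-monoʳ-≤ t′ (+-mono-≤ pf pg) ⟩
    t′ * (B * t + B * t)   ≡⟨ e2 t′ B t ⟩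
    t′ * t * (2 * B)       <⟨ *-monoʳ-< (t′ * t) {{>-nonZero pos}} lt ⟩
    t′ * t * (β * T)       ≡⟨ e3 t′ t β T ⟩
    β * (t′ * (t * T))     ≡⟨ cong (λ l → β * (t′ * (falling T l * T))) (≡-sym len) ⟩
    β * (t′ * (falling T (length R) * T)) ≡⟨ cong (λ z → β * (t′ * z)) (≡-sym (Σdraws-const T R T)) ⟩
    β * (t′ * Σdraws T R (λ _ _ → T)) ≡⟨ cong (β *_) (≡-sym (inner (λ _ → T))) ⟩
    β * Σdraws T R (λ a R′ → Σdraws T R′ (λ _ _ → T)) ∎)
... | a , R′ , d , e , lt′ with Σdraws-exists T R′ lt′
... | b , R″ , d′ , e′ , lt″ =
  a , b , R′ , R″ , d , d′ , e , e′ , ≤-<-trans (m≤m+n _ _) lt″ , ≤-<-trans (m≤n+m _ _) lt″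

-- Densest subgraphs and their expansion

module _ {n : ℕ} (G : SimpleGraph n) where

  E : VSet n → VSet n → ℕ
  E X Y = ∑ (λ u → ∑ (λ v → ι (X u ∧ (Y v ∧ adj G u v))))

  -- counts ordered pairs: twice the number of edges inside X
  D : VSet n → ℕ
  D X = E X X

  E-cong : ∀ {X X′ Y Y′} → (∀ v → X v ≡ X′ v) → (∀ v → Y v ≡ Y′ v) → E X Y ≡ E X′ Y′
  E-cong p q = ∑-cong (λ u → ∑-cong (λ v → cong₂ (λ a b → ι (a ∧ (b ∧ adj G u v))) (p u) (q v)))

  D-mono : ∀ {X Y} → X ⊑ Y → D X ≤ D Y
  D-mono {X} {Y} h = ∑-mono (λ u → ∑-mono (λ v → pt u v))
    where
    pt : ∀ u v → ι (X u ∧ (X v ∧ adj G u v)) ≤ ι (Y u ∧ (Y v ∧ adj G u v))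
    pt u v with X u in eu | X v in ev
    ... | false | _ = z≤n
    ... | true | false = z≤n
    ... | true | true rewrite h u eu | h v ev = ≤-refl

  D≤∣∣² : ∀ X → D X ≤ ∣ X ∣ * ∣ X ∣
  D≤∣∣² X = begin
    D X                              ≤⟨ ∑-mono (λ u → ∑-mono (λ v → pt (X u) (X v) (adj G u v))) ⟩
    ∑ (λ u → ∑ (λ v → ι (X u) * ι (X v))) ≡⟨ ∑-cong (λ u → ∑-*ˡ (ι (X u)) (λ v → ι (X v))) ⟩
    ∑ (λ u → ι (X u) * ∣ X ∣)        ≡⟨ ∑-*ʳ (λ u → ι (X u)) ∣ X ∣ ⟩
    ∣ X ∣ * ∣ X ∣                    ∎
    where
    open ≤-Reasoning
    pt : ∀ a b c → ι (a ∧ (b ∧ c)) ≤ ι a * ι b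
    pt false b c = z≤n
    pt true false c = z≤n
    pt true true c = ι≤1 c

  -- An edge of H that meets S either ends outside S′, and is then found once for each orientation,
  -- or has both ends in S′ because S ⊑ S′.
  edges-split : ∀ {S S′ H} → S ⊑ S′ →
    D H ≤ D (H ∖ˢ S) + 2 * E S (H ∖ˢ S′) + D S′
  edges-split {S} {S′} {H} S⊑S′ = begin
    D H
      ≤⟨ ∑-mono (λ u → ∑-mono (λ v → pt′ u v)) ⟩
    ∑ (λ u → ∑ (λ v → (a u v + (b u v + b v u)) + d u v))
      ≡⟨ ∑∑-+ (λ u v → a u v + (b u v + b v u)) d ⟩
    ∑ (λ u → ∑ (λ v → a u v + (b u v + b v u))) + D S′
      ≡⟨ cong (_+ D S′) (trans (∑∑-+ a (λ u v → b u v + b v u)) (cong (D (H ∖ˢ S) +_) (∑∑-+ b (λ u v → b v u)))) ⟩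
    D (H ∖ˢ S) + (E S (H ∖ˢ S′) + ∑ (λ u → ∑ (λ v → b v u))) + D S′
      ≡⟨ cong (λ z → D (H ∖ˢ S) + (E S (H ∖ˢ S′) + z) + D S′) (≡-sym (trans (∑-swap b) refl)) ⟩
    D (H ∖ˢ S) + (E S (H ∖ˢ S′) + E S (H ∖ˢ S′)) + D S′
      ≡⟨ cong (λ z → D (H ∖ˢ S) + z + D S′) (cong (E S (H ∖ˢ S′) +_) (≡-sym (+-identityʳ _))) ⟩
    D (H ∖ˢ S) + 2 * E S (H ∖ˢ S′) + D S′ ∎
    where
    open ≤-Reasoning
    a b d : Fin n → Fin n → ℕ
    a u v = ι ((H u ∧ not (S u)) ∧ ((H v ∧ not (S v)) ∧ adj G u v))
    b u v = ι (S u ∧ ((H v ∧ not (S′ v)) ∧ adj G u v))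
    d u v = ι (S′ u ∧ (S′ v ∧ adj G u v))
    ∑∑-+ : ∀ (f g : Fin n → Fin n → ℕ) → ∑ (λ u → ∑ (λ v → f u v + g u v)) ≡ ∑ (λ u → ∑ (f u)) + ∑ (λ u → ∑ (g u))
    ∑∑-+ f g = trans (∑-cong (λ u → ∑-+ (f u) (g u))) (∑-+ (λ u → ∑ (f u)) (λ u → ∑ (g u)))
    pt : ∀ hu hv su sv tu tv e → (su ≡ true → tu ≡ true) → (sv ≡ true → tv ≡ true) →
      ι (hu ∧ (hv ∧ e)) ≤
      (ι ((hu ∧ not su) ∧ ((hv ∧ not sv) ∧ e)) + (ι (su ∧ ((hv ∧ not tv) ∧ e)) + ι (sv ∧ ((hu ∧ not tu) ∧ e))))
      + ι (tu ∧ (tv ∧ e))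
    pt false hv su sv tu tv e _ _ = z≤n
    pt true false su sv tu tv e _ _ = z≤n
    pt true true su sv tu tv false _ _ = z≤n
    pt true true false false tu tv true _ _ = s≤s z≤n
    pt true true true sv true true true _ _ = m≤n+m 1 _
    pt true true true sv true false true _ _ = s≤s z≤n
    pt true true true sv false tv true h _ with h refl
    ... | ()
    pt true true false true true true true _ _ = s≤s z≤n
    pt true true false true false true true _ _ = s≤s z≤n
    pt true true false true tu false true _ h with h refl
    ... | ()
    pt′ : ∀ u v → ι (H u ∧ (H v ∧ adj G u v)) ≤ (a u v + (b u v + b v u)) + d u v
    pt′ u v rewrite sym G v u = pt (H u) (H v) (S u) (S v) (S′ u) (S′ v) (adj G u v) (S⊑S′ u) (S⊑S′ v)

  Densest : (ℕ → ℕ) → VSet n → Set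
  Densest w H = ∀ X → X ⊑ H → D X * w ∣ H ∣ ≤ D H * w ∣ X ∣

  -- Descent: pass to a subset of larger ratio D / w while there is one. Such a subset is strictly
  -- smaller, since at equal size the weights agree and D is monotone; it is nonempty because its D
  -- is positive.
  densest-subset : ∀ (w : ℕ → ℕ) H₀ → 0 < ∣ H₀ ∣ →
    ∃[ H ] (0 < ∣ H ∣ × D H₀ * w ∣ H ∣ ≤ D H * w ∣ H₀ ∣ × Densest w H)
  densest-subset w H₀ pos = <-rec Goal step ∣ H₀ ∣ H₀ refl pos ≤-refl
    where
    Goal : ℕ → Set
    Goal m = ∀ H → ∣ H ∣ ≡ m → 0 < ∣ H ∣ → D H₀ * w ∣ H ∣ ≤ D H * w ∣ H₀ ∣ →
      ∃[ H ] (0 < ∣ H ∣ × D H₀ * w ∣ H ∣ ≤ D H * w ∣ H₀ ∣ × Densest w H)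
    step : ∀ m → (∀ {k} → k < m → Goal k) → Goal m
    step m rec H eq 0<H inv
      with anySubset? (λ V → Fin.all? (λ v → is? (Vec.lookup V) v →-dec is? H v)
                             ×-dec (D H * w ∣ Vec.lookup V ∣ <? D (Vec.lookup V) * w ∣ H ∣))
    ... | yes (V , Y⊑H , lt) = rec smaller Y refl 0<Y inv′
      where
      Y = Vec.lookup V
      Y≤H : ∣ Y ∣ ≤ ∣ H ∣
      Y≤H = ⊑⇒∣∣≤ Y⊑H
      Y≢H : ∣ Y ∣ ≢ ∣ H ∣
      Y≢H e = <⇒≱ lt (subst (λ k → D Y * w ∣ H ∣ ≤ D H * w k) (≡-sym e) (*-monoˡ-≤ (w ∣ H ∣) (D-mono Y⊑H)))
      smaller : ∣ Y ∣ < m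
      smaller = subst (∣ Y ∣ <_) eq (≤∧≢⇒< Y≤H Y≢H)
      DY*w>0 : 0 < D Y * w ∣ H ∣
      DY*w>0 = ≤-<-trans z≤n lt
      0<Y : 0 < ∣ Y ∣
      0<Y = n≢0⇒n>0 (λ e → <⇒≱ DY*w>0 (≤-trans (*-monoˡ-≤ (w ∣ H ∣) (≤-trans (D≤∣∣² Y) (≤-reflexive (cong (λ k → k * k) e)))) z≤n))
      w≢0 : NonZero (w ∣ H ∣)
      w≢0 = ≢-nonZero (λ e → <⇒≱ DY*w>0 (≤-reflexive (trans (cong (D Y *_) e) (*-zeroʳ (D Y)))))
      open ≤-Reasoning
      e1 : ∀ a b c → a * b * c ≡ a * c * b
      e1 = solve-∀
      inv′ : D H₀ * w ∣ Y ∣ ≤ D Y * w ∣ H₀ ∣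
      inv′ = *-cancelʳ-≤ _ _ (w ∣ H ∣) {{w≢0}} (begin
        D H₀ * w ∣ Y ∣ * w ∣ H ∣   ≡⟨ e1 (D H₀) _ _ ⟩
        D H₀ * w ∣ H ∣ * w ∣ Y ∣   ≤⟨ *-monoˡ-≤ (w ∣ Y ∣) inv ⟩
        D H * w ∣ H₀ ∣ * w ∣ Y ∣   ≡⟨ e1 (D H) _ _ ⟩
        D H * w ∣ Y ∣ * w ∣ H₀ ∣   ≤⟨ *-monoˡ-≤ (w ∣ H₀ ∣) (<⇒≤ lt) ⟩
        D Y * w ∣ H ∣ * w ∣ H₀ ∣   ≡⟨ e1 (D Y) _ _ ⟩
        D Y * w ∣ H₀ ∣ * w ∣ H ∣   ∎)
    ... | no none = H , 0<H , inv , densest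
      where
      densest : Densest w H
      densest X X⊑H = subst₂ _≤_ (cong₂ _*_ (E-cong same same) refl)
          (cong (λ k → D H * w k) (∑-cong (λ v → cong ι (same v))))
          (≮⇒≥ (λ lt → none (V , (λ v e → X⊑H v (trans (≡-sym (same v)) e)) , lt)))
        where
        V = Vec.tabulate X
        same : ∀ v → Vec.lookup V v ≡ X v
        same = lookup∘tabulate X

  module Expansion (φ : ℕ → ℕ) (φ-mono : ∀ {a b} → a ≤ b → φ a ≤ φ b) (H : VSet n)
                   (H≠∅ : 0 < ∣ H ∣) (den : Densest (λ m → m * φ m) H) where
    N = ∣ H ∣

    -- D(H) − D(H ∖ S) − D(S′) bounds twice the number of edges from S to H ∖ S′ from below, and
    -- both subtracted terms are controlled by the maximality of H.
    cut-lower : ∀ {S S′} → S ⊑ S′ → S′ ⊑ H →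
      D H * (∣ S ∣ * φ N) ≤ 2 * E S (H ∖ˢ S′) * (N * φ N) + D H * (∣ S′ ∣ * φ ∣ S′ ∣)
    cut-lower {S} {S′} S⊑S′ S′⊑H = +-cancelˡ-≤ (D H * (r * φ N)) _ _ (begin
      D H * (r * φ N) + D H * (s * φ N)      ≡⟨ e1 (D H) r s (φ N) ⟩
      D H * ((r + s) * φ N)                  ≡⟨ cong (λ z → D H * (z * φ N)) (∣∖∣ H S S⊑H) ⟩
      D H * (N * φ N)                        ≤⟨ *-monoˡ-≤ (N * φ N) (edges-split S⊑S′) ⟩
      (D (H ∖ˢ S) + 2 * e + D S′) * (N * φ N)  ≡⟨ e2 (D (H ∖ˢ S)) (2 * e) (D S′) (N * φ N) ⟩
      D (H ∖ˢ S) * (N * φ N) + (2 * e * (N * φ N) + D S′ * (N * φ N))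
        ≤⟨ +-mono-≤ (≤-trans (den (H ∖ˢ S) H∖S⊑H) (*-monoʳ-≤ (D H) (*-monoʳ-≤ r (φ-mono (⊑⇒∣∣≤ H∖S⊑H)))))
                    (+-monoʳ-≤ (2 * e * (N * φ N)) (den S′ S′⊑H)) ⟩
      D H * (r * φ N) + (2 * e * (N * φ N) + D H * (∣ S′ ∣ * φ ∣ S′ ∣)) ∎)
      where
      open ≤-Reasoning
      S⊑H : S ⊑ H
      S⊑H v p = S′⊑H v (S⊑S′ v p)
      s = ∣ S ∣
      r = ∣ H ∖ˢ S ∣
      e = E S (H ∖ˢ S′)
      H∖S⊑H : (H ∖ˢ S) ⊑ H
      H∖S⊑H v p with H v | p
      ... | true | _ = refl
      ... | false | ()
      e1 : ∀ d r s f → d * (r * f) + d * (s * f) ≡ d * ((r + s) * f)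
      e1 = solve-∀
      e2 : ∀ a b c x → (a + b + c) * x ≡ a * x + (b * x + c * x)
      e2 = solve-∀

    -- The first inequality leaves a gap of k / 4 in weight per vertex of S. Inserted in
    -- `cut-lower`, it yields D H · k / (8 N φ N) edges per vertex of S; with average degree d in H
    -- this is at least d k / (8 φ N) ≥ b.
    expansion : ∀ {S S′ k d b} → S ⊑ S′ → S′ ⊑ H →
      4 * (∣ S′ ∣ * φ ∣ S′ ∣) + k * ∣ S ∣ ≤ 4 * (∣ S ∣ * φ N) →
      N * d ≤ D H → 8 * (φ N * b) ≤ d * k → 0 < φ N →
      b * ∣ S ∣ ≤ E S (H ∖ˢ S′)
    expansion {S} {S′} {k} {d} {b} S⊑S′ S′⊑H small dens bk φ>0 =
      *-cancelˡ-≤ (8 * (N * φ N)) {{m*n≢0 8 (N * φ N) {{_}} {{m*n≢0 N (φ N) {{>-nonZero H≠∅}} {{>-nonZero φ>0}}}}}} (begin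
        8 * (N * φ N) * (b * s)     ≡⟨ e1 N (φ N) b s ⟩
        N * (8 * (φ N * b)) * s     ≤⟨ *-monoˡ-≤ s (*-monoʳ-≤ N bk) ⟩
        N * (d * k) * s             ≡⟨ e2 N d k s ⟩
        N * d * (k * s)             ≤⟨ *-monoˡ-≤ (k * s) dens ⟩
        D H * (k * s)               ≤⟨ main ⟩
        8 * e * (N * φ N)           ≡⟨ e3 e (N * φ N) ⟩
        8 * (N * φ N) * e           ∎)
      where
      open ≤-Reasoning
      s = ∣ S ∣
      e = E S (H ∖ˢ S′)
      x = ∣ S′ ∣ * φ ∣ S′ ∣
      e1 : ∀ N f b s → 8 * (N * f) * (b * s) ≡ N * (8 * (f * b)) * s
      e1 = solve-∀
      e2 : ∀ N d k s → N * (d * k) * s ≡ N * d * (k * s)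
      e2 = solve-∀
      e3 : ∀ e x → 8 * e * x ≡ 8 * x * e
      e3 = solve-∀
      e4 : ∀ D x k → 4 * (D * x) + D * k ≡ D * (4 * x + k)
      e4 = solve-∀
      e5 : ∀ D y → D * (4 * y) ≡ 4 * (D * y)
      e5 = solve-∀
      e6 : ∀ e y z → 4 * (2 * e * y + z) ≡ 4 * z + 8 * e * y
      e6 = solve-∀
      main : D H * (k * s) ≤ 8 * e * (N * φ N)
      main = +-cancelˡ-≤ (4 * (D H * x)) _ _ (begin
        4 * (D H * x) + D H * (k * s)         ≡⟨ e4 (D H) x (k * s) ⟩
        D H * (4 * x + k * s)                 ≤⟨ *-monoʳ-≤ (D H) small ⟩
        D H * (4 * (s * φ N))                 ≡⟨ e5 (D H) (s * φ N) ⟩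
        4 * (D H * (s * φ N))                 ≤⟨ *-monoʳ-≤ 4 (cut-lower S⊑S′ S′⊑H) ⟩
        4 * (2 * e * (N * φ N) + D H * x)     ≡⟨ e6 e (N * φ N) (D H * x) ⟩
        4 * (D H * x) + 8 * e * (N * φ N)     ∎)

-- Trails

Unique-resp-⊆ : ∀ {A : Set} {xs ys : List A} → xs ⊆ ys → Unique ys → Unique xs
Unique-resp-⊆ [] [] = []
Unique-resp-⊆ (_ ∷ʳ p) (_ ∷ u) = Unique-resp-⊆ p u
Unique-resp-⊆ (refl ∷ p) (a ∷ u) = All-resp-⊆ p a ∷ Unique-resp-⊆ p u

module _ {n : ℕ} {G : SimpleGraph n} (c : EdgeColouring G) where

  private
    V = Fin n
    variable
      v w x y z : V
      ws vs : List V
      ds : List ℕ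

  -- Trail y v ws cs: a walk from v to y visiting ws after v, with edge colours cs
  data Trail (y : V) : V → List V → List ℕ → Set where
    nil  : Trail y y [] []
    cons : ∀ {d} → Edge G v w → col c v w ≡ d → Trail y w ws ds → Trail y v (w ∷ ws) (d ∷ ds)

  trail-isWalk : Trail y v ws ds → IsWalk G (v ∷ ws)
  trail-isWalk nil = tt
  trail-isWalk (cons e _ t) = e , trail-isWalk t

  trail-colours : Trail y v ws ds → walkColours c (v ∷ ws) ≡ ds
  trail-colours nil = refl
  trail-colours (cons _ q t) = cong₂ _∷_ q (trail-colours t)

  trail-length : Trail y v ws ds → length ws ≡ length ds
  trail-length nil = refl
  trail-length (cons _ _ t) = cong suc (trail-length t)

  private
    trail-snoc : Trail y v (w ∷ ws) ds → ∃[ is ] (w ∷ ws ≡ is ++ [ y ])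
    trail-snoc (cons _ _ nil) = [] , refl
    trail-snoc (cons {w = w} _ _ t@(cons _ _ _)) with trail-snoc t
    ... | is , q = w ∷ is , cong (w ∷_) q

  trail-end : Trail y v ws ds → v ≢ y → ∃[ is ] (ws ≡ is ++ [ y ])
  trail-end nil ne = ⊥-elim (ne refl)
  trail-end t@(cons _ _ _) ne = trail-snoc t

  private
    open DecMem (Fin._≟_ {n}) using (_∈?_)

    suffix : Trail y w ws ds → Unique (w ∷ ws) → v ∈ (w ∷ ws) →
      ∃[ ws′ ] ∃[ ds′ ] (Trail y v ws′ ds′ × Unique (v ∷ ws′) × ws′ ⊆ ws × ds′ ⊆ ds)
    suffix t u (here refl) = _ , _ , t , u , ⊆-refl , ⊆-refl
    suffix (cons _ _ t) (_ ∷ u) (there m) with suffix t u m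
    ... | ws′ , ds′ , t′ , u′ , p , q = ws′ , ds′ , t′ , u′ , _ ∷ʳ p , _ ∷ʳ q

  -- The result is tracked as sublists of vertices and of colours, so distinctness of colours and
  -- all avoidance conditions are inherited.
  loop-erase : Trail y v ws ds →
    ∃[ ws′ ] ∃[ ds′ ] (Trail y v ws′ ds′ × Unique (v ∷ ws′) × ws′ ⊆ ws × ds′ ⊆ ds)
  loop-erase nil = _ , _ , nil , [] ∷ [] , [] , []
  loop-erase {v = v} (cons {w = w} e q t) with loop-erase t
  ... | ws′ , ds′ , t′ , u′ , p , r with v ∈? (w ∷ ws′)
  ... | no v∉ = _ , _ , cons e q t′ , ¬Any⇒All¬ _ v∉ ∷ u′ , refl ∷ p , refl ∷ r
  ... | yes v∈ with suffix t′ u′ v∈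
  ... | ws″ , ds″ , t″ , u″ , p′ , r′ =
    ws″ , ds″ , t″ , u″ , ⊆-trans p′ (_ ∷ʳ p) , ⊆-trans r′ (_ ∷ʳ r)

  -- Both trails run from the meeting vertex z to their roots, so the first is reversed, edge by
  -- edge, onto the front of the second.
  splice : Trail x z ws cs → Trail y z vs ds → Unique cs → Unique ds → Disjoint cs ds →
    ∃[ us ] ∃[ es ] (Trail y x us es × Unique es × (∀ {e} → e ∈ es → e ∈ cs ⊎ e ∈ ds) ×
      (∀ {u} → u ∈ us → u ∈ (z ∷ ws) ⊎ u ∈ vs) × length es ≡ length cs + length ds)
  splice nil t′ _ u′ _ = _ , _ , t′ , u′ , inj₂ , inj₂ , refl
  splice {cs = d ∷ cs} {ds = ds} (cons {v = z} {w = w} e q t) t′ (a ∷ u) u′ dis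
    with splice t (cons (trans (sym G w z) e) (trans (≡-sym (colSym c z w e)) q) t′)
           u (¬Any⇒All¬ _ (dis (here refl)) ∷ u′) dis′
    where
    dis′ : Disjoint cs (d ∷ ds)
    dis′ m (here refl) = All.lookup a m refl
    dis′ m (there m′) = dis (there m) m′
  ... | us , es , t″ , u″ , inE , inV , len = us , es , t″ , u″ , (λ m → shift (inE m)) , (λ m → shift (inV m)) , trans len (+-suc _ _)
    where
    shift : ∀ {A : Set} {a b : A} {as bs : List A} → a ∈ as ⊎ a ∈ (b ∷ bs) → a ∈ (b ∷ as) ⊎ a ∈ bs
    shift (inj₁ i) = inj₁ (there i)
    shift (inj₂ (here i)) = inj₁ (here i)
    shift (inj₂ (there i)) = inj₂ i

  record Link (x y : V) (W : List V) (F : List ℕ) (m : ℕ) : Set where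
    field
      inner : List V
    walk : List V
    walk = x ∷ inner ++ [ y ]
    field
      walk-ok    : IsWalk G walk
      unique     : Unique inner
      avoidsV    : ∀ {v} → v ∈ inner → v ∉ W
      rainbow    : Unique (walkColours c walk)
      avoidsC    : ∀ {d} → d ∈ walkColours c walk → d ∉ F
      inner≤     : length inner ≤ m
      colours≤   : length (walkColours c walk) ≤ m

  -- In use W contains every branch vertex, hence also the root x of the trail. The exception for x
  -- is harmless, as loop erasure keeps both roots out of the interior of the path.
  Avoids : V → List V → V → Set
  Avoids x W v = v ≡ x ⊎ v ∉ W

  link : ∀ {W F ℓ} → x ≢ y → Trail x z ws cs → Trail y z vs ds → Unique cs → Unique ds → Disjoint cs ds →
    (∀ {v} → v ∈ (z ∷ ws) → Avoids x W v) → (∀ {v} → v ∈ vs → Avoids y W v) →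
    (∀ {d} → d ∈ cs → d ∉ F) → (∀ {d} → d ∈ ds → d ∉ F) → length cs ≤ ℓ → length ds ≤ ℓ →
    Link x y W F (ℓ + ℓ)
  link {x = x} {y = y} {W = W} {F} {ℓ} x≢y t t′ u u′ dis aw av fc fd lc ld
    with splice t t′ u u′ dis
  ... | us₀ , es₀ , t₀ , u₀ , inE , inV , len with loop-erase t₀
  ... | us , es , t₁ , ux ∷ uu , p , r with trail-end t₁ x≢y
  ... | is , refl = record
    { inner = is
    ; walk-ok = trail-isWalk t₁
    ; unique = Unique-resp-⊆ (++⁺ʳ _ ⊆-refl) uu
    ; avoidsV = λ m → inner-avoids m
    ; rainbow = subst Unique (≡-sym cols) (Unique-resp-⊆ r u₀)
    ; avoidsC = λ m → avoidsC (Sublist.lookup r (subst (_ ∈_) cols m))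
    ; inner≤ = ≤-trans (≤-trans (m≤m+n _ 1) (≤-reflexive (≡-sym (length-++ is)))) (≤-trans (≤-reflexive (trail-length t₁)) es≤)
    ; colours≤ = ≤-trans (≤-reflexive (cong length cols)) es≤
    }
    where
    cols = trail-colours t₁
    es≤ : length es ≤ ℓ + ℓ
    es≤ = ≤-trans (length-mono-≤ r) (≤-trans (≤-reflexive len) (+-mono-≤ lc ld))
    avoidsC : ∀ {d} → d ∈ es₀ → d ∉ F
    avoidsC m with inE m
    ... | inj₁ i = fc i
    ... | inj₂ i = fd i
    ≢y : ∀ {v} → v ∈ is → v ≢ y
    ≢y = go uu
      where
      go : ∀ {is v} → Unique (is ++ [ y ]) → v ∈ is → v ≢ y
      go {i ∷ is} (a ∷ u) (here refl) = All.lookup a (∈-++⁺ʳ is (here refl))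
      go (a ∷ u) (there m) = go u m
    inner-avoids : ∀ {v} → v ∈ is → v ∉ W
    inner-avoids {v} m with inV (Sublist.lookup p (∈-++⁺ˡ m))
    ... | inj₁ i = case-x (aw i)
      where
      case-x : Avoids x W v → v ∉ W
      case-x (inj₁ e) = ⊥-elim (All.lookup ux (∈-++⁺ˡ m) (≡-sym e))
      case-x (inj₂ a) = a
    ... | inj₂ i = case-y (av i)
      where
      case-y : Avoids y W v → v ∉ W
      case-y (inj₁ e) = ⊥-elim (≢y m e)
      case-y (inj₂ a) = a

-- The growth process

module _ {n : ℕ} (G : SimpleGraph n) where

  edge? : ∀ u v → Dec (Edge G u v)
  edge? u v = adj G u v Bool.≟ true

  Edge-sym : ∀ {u v} → Edge G u v → Edge G v u
  Edge-sym {u} {v} e = trans (sym G v u) e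

module _ {n : ℕ} {G : SimpleGraph n} (c : EdgeColouring G) (proper : Proper c) where

  open DecMem _≟_ using (_∈?_)
  open DecMem (Fin._≟_ {n}) using () renaming (_∈?_ to _∈ⱽ?_)

  colour-injective : ∀ {u v w} → Edge G u v → Edge G u w → col c u v ≡ col c u w → v ≡ w
  colour-injective {u} {v} {w} e e′ q with v Fin.≟ w
  ... | yes p = p
  ... | no ne = ⊥-elim (proper u v w e e′ ne q)

  -- One batch: S is the set reached so far, C v the colours of the chosen trail to v ∈ S.
  module Batch (H S : VSet n) (C : Fin n → List ℕ) (W : List (Fin n)) (F : List ℕ) where

    -- Besides F, the colours of the trail `C v` must be excluded here: the list A of drawn colours
    -- is kept from batch to batch, so a colour in A may already occur on that trail.
    Usable : Fin n → Fin n → Set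
    Usable v w = S v ≡ true × ¬ (S w ≡ true) × H w ≡ true × w ∉ W × Edge G v w × col c v w ∉ F × col c v w ∉ C v

    abstract
      usable? : ∀ v w → Dec (Usable v w)
      usable? v w = is? S v ×-dec ¬? (is? S w) ×-dec is? H w ×-dec ¬? (w ∈ⱽ? W) ×-dec edge? G v w
                  ×-dec ¬? (col c v w ∈? F) ×-dec ¬? (col c v w ∈? C v)

    usable-edge : ∀ {v w} → Usable v w → Edge G v w
    usable-edge (_ , _ , _ , _ , e , _) = e

    InU : List ℕ → Fin n → Set
    InU A w = ∃[ v ] (Usable v w × col c v w ∈ A)

    abstract
      inU? : ∀ A w → Dec (InU A w)
      inU? A w = Fin.any? (λ v → usable? v w ×-dec (col c v w ∈? A))

    U : List ℕ → VSet n
    U A w = does (inU? A w)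

    U⁻ : ∀ A {w} → U A w ≡ true → InU A w
    U⁻ A {w} = does⁻ (inU? A w)

    New : List ℕ → Fin n → Fin n → Set
    New A v w = Usable v w × ¬ InU A w

    abstract
      new? : ∀ A v w → Dec (New A v w)
      new? A v w = usable? v w ×-dec ¬? (inU? A w)

    gain : List ℕ → ℕ → ℕ
    gain A d = ∑ (λ w → ∑ (λ v → χ (new? A v w ×-dec (col c v w ≟ d))))

    S∩U : ∀ A v → S v ≡ true → U A v ≡ true → ⊥
    S∩U A v s u with U⁻ A u
    ... | _ , (_ , ¬s , _) , _ = ¬s s

    S⊑S∪U : ∀ A → S ⊑ (S ∪ˢ U A)
    S⊑S∪U A v s rewrite s = refl

    S∪U⊑H : ∀ A → S ⊑ H → (S ∪ˢ U A) ⊑ H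
    S∪U⊑H A S⊑H v p with ∨⁻ p
    ... | inj₁ e = S⊑H v e
    ... | inj₂ u = proj₁ (proj₂ (proj₂ (proj₁ (proj₂ (U⁻ A u)))))

    -- By properness w has at most one edge of colour d, so counting new edges of colour d counts
    -- vertices, and all of them are outside `U A`.
    gain-U : ∀ A d → ∣ U A ∣ + gain A d ≤ ∣ U (d ∷ A) ∣
    gain-U A d = ≤-trans (≤-reflexive (≡-sym (∑-+ (λ w → ι (U A w)) _))) (∑-mono pt)
      where
      pt : ∀ w → ι (U A w) + ∑ (λ v → χ (new? A v w ×-dec (col c v w ≟ d))) ≤ ι (U (d ∷ A) w)
      pt w = split (inU? A w)
        where
        split : (i : Dec (InU A w)) → χ i + ∑ (λ v → χ (new? A v w ×-dec (col c v w ≟ d))) ≤ χ (inU? (d ∷ A) w)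
        split (no _) = ∑-χ≤χ∃ (λ v → new? A v w ×-dec (col c v w ≟ d)) (inU? (d ∷ A) w)
          (λ ((us , _) , e) ((us′ , _) , e′) →
             colour-injective (Edge-sym G (usable-edge us)) (Edge-sym G (usable-edge us′))
               (trans (≡-sym (colSym c _ _ (usable-edge us))) (trans (trans e (≡-sym e′)) (colSym c _ _ (usable-edge us′)))))
          (λ v ((us , _) , e) → v , us , here e)
        split (yes i@(v , us , m)) =
          ≤-trans (≤-reflexive (cong suc (trans (∑-cong (λ v → χ-no (new? A v w ×-dec (col c v w ≟ d)) (λ ((_ , ¬i) , _) → ¬i i))) (∑-zero {n}))))
                  (1≤χ (inU? (d ∷ A) w) (v , us , there m))

    gain≤∣S∣ : ∀ A d → gain A d ≤ ∣ S ∣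
    gain≤∣S∣ A d = ≤-trans (≤-reflexive (∑-swap (λ w v → χ (new? A v w ×-dec (col c v w ≟ d))))) (∑-mono pt)
      where
      pt : ∀ v → ∑ (λ w → χ (new? A v w ×-dec (col c v w ≟ d))) ≤ ι (S v)
      pt v = ≤-trans (∑-χ≤χ∃ (λ w → new? A v w ×-dec (col c v w ≟ d)) (is? S v)
               (λ ((us , _) , e) ((us′ , _) , e′) → colour-injective (usable-edge us) (usable-edge us′) (trans e (≡-sym e′)))
               (λ w (((s , _) , _) , _) → s))
             (≤-reflexive (χ-is S v))

    -- The surplus over β pays at each v in S for the edges lost to the colours of its trail (at
    -- most ℓ), to F and to W. Every other edge into the complement of S ∪ U is new.
    new-lower : ∀ A {β ℓ} → (∀ v → S v ≡ true → length (C v) ≤ ℓ) →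
      (β + (ℓ + length F + length W)) * ∣ S ∣ ≤ E G S (H ∖ˢ (S ∪ˢ U A)) →
      β * ∣ S ∣ ≤ ∑ (λ w → ∑ (λ v → χ (new? A v w)))
    new-lower A {β} {ℓ} short ex = +-cancelʳ-≤ (∣ S ∣ * L) _ _ (begin
      β * ∣ S ∣ + ∣ S ∣ * L                           ≡⟨ e1 β ∣ S ∣ L ⟩
      (β + L) * ∣ S ∣                                 ≤⟨ ex ⟩
      E G S (H ∖ˢ (S ∪ˢ U A))                         ≤⟨ ∑-mono row ⟩
      ∑ (λ v → ∑ (λ w → χ (new? A v w)) + ι (S v) * L) ≡⟨ ∑-+ (λ v → ∑ (λ w → χ (new? A v w))) _ ⟩
      ∑ (λ v → ∑ (λ w → χ (new? A v w))) + ∑ (λ v → ι (S v) * L)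
        ≡⟨ cong₂ _+_ (∑-swap (λ v w → χ (new? A v w))) (∑-*ʳ (λ v → ι (S v)) L) ⟩
      ∑ (λ w → ∑ (λ v → χ (new? A v w))) + ∣ S ∣ * L  ∎)
      where
      open ≤-Reasoning
      L = ℓ + length F + length W
      e1 : ∀ β s L → β * s + s * L ≡ (β + L) * s
      e1 = solve-∀
      Z = H ∖ˢ (S ∪ˢ U A)
      bad : Fin n → Fin n → ℕ
      bad v w = χ (edge? G v w ×-dec (col c v w ∈? C v)) + χ (edge? G v w ×-dec (col c v w ∈? F)) + χ (yes tt ×-dec (w ∈ⱽ? W))
      ∑-bad : ∀ v → S v ≡ true → ∑ (bad v) ≤ L
      ∑-bad v s = begin
        ∑ (bad v) ≡⟨ trans (∑-+ (λ w → χ (edge? G v w ×-dec (col c v w ∈? C v)) + χ (edge? G v w ×-dec (col c v w ∈? F))) _)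
                           (cong (_+ ∑ (λ w → χ (yes tt ×-dec (w ∈ⱽ? W)))) (∑-+ (λ w → χ (edge? G v w ×-dec (col c v w ∈? C v))) _)) ⟩
        ∑ (λ w → χ (edge? G v w ×-dec (col c v w ∈? C v))) + ∑ (λ w → χ (edge? G v w ×-dec (col c v w ∈? F)))
          + ∑ (λ w → χ (yes tt ×-dec (w ∈ⱽ? W)))
          ≤⟨ +-mono-≤ (+-mono-≤ (≤-trans (∑-χ∈≤length _≟_ (edge? G v) (col c v) colour-injective (C v)) (short v s))
                                (∑-χ∈≤length _≟_ (edge? G v) (col c v) colour-injective F))
                      (∑-χ∈≤length Fin._≟_ (λ _ → yes tt) (λ w → w) (λ _ _ q → q) W) ⟩
        L ∎
      pt : ∀ v w → S v ≡ true → ι (Z w ∧ adj G v w) ≤ χ (new? A v w) + bad v w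
      pt v w s = ι≤ h
        where
        h : Z w ∧ adj G v w ≡ true → 1 ≤ χ (new? A v w) + bad v w
        h p with ∧⁻ {Z w} p
        ... | z , e with ∧⁻ {H w} z
        ... | hw , ¬su = split (col c v w ∈? C v) (col c v w ∈? F) (w ∈ⱽ? W)
          where
          ¬s : ¬ (S w ≡ true)
          ¬s q = not⁻ ¬su (cong (_∨ U A w) q)
          ¬u : ¬ InU A w
          ¬u i = not⁻ ¬su (trans (cong (S w ∨_) (does⁺ (inU? A w) i)) (Bool.∨-zeroʳ (S w)))
          split : (i : Dec (col c v w ∈ C v)) (j : Dec (col c v w ∈ F)) (k : Dec (w ∈ W)) →
            1 ≤ χ (new? A v w) + (χ (edge? G v w ×-dec i) + χ (edge? G v w ×-dec j) + χ (yes tt ×-dec k))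
          x = χ (new? A v w)
          split i@(yes m) j k = ≤-trans (1≤χ (edge? G v w ×-dec i) (e , m))
            (≤-trans (m≤m+n _ (χ (edge? G v w ×-dec j))) (≤-trans (m≤m+n _ (χ (yes tt ×-dec k))) (m≤n+m _ x)))
          split i@(no _) j@(yes m) k = ≤-trans (1≤χ (edge? G v w ×-dec j) (e , m))
            (≤-trans (m≤n+m _ (χ (edge? G v w ×-dec i))) (≤-trans (m≤m+n _ (χ (yes tt ×-dec k))) (m≤n+m _ x)))
          split i@(no _) j@(no _) k@(yes m) = ≤-trans (1≤χ (yes tt ×-dec k) (tt , m))
            (≤-trans (m≤n+m _ (χ (edge? G v w ×-dec i) + χ (edge? G v w ×-dec j))) (m≤n+m _ x))
          split (no a) (no b) (no d) = ≤-trans (1≤χ (new? A v w) ((s , ¬s , hw , d , e , b , a) , ¬u)) (m≤m+n _ _)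
      row : ∀ v → ∑ (λ w → ι (S v ∧ (Z w ∧ adj G v w))) ≤ ∑ (λ w → χ (new? A v w)) + ι (S v) * L
      row v with S v in s
      ... | false = ≤-trans (≤-reflexive (∑-zero {n})) z≤n
      ... | true = begin
        ∑ (λ w → ι (Z w ∧ adj G v w))       ≤⟨ ∑-mono (λ w → pt v w s) ⟩
        ∑ (λ w → χ (new? A v w) + bad v w)  ≡⟨ ∑-+ (λ w → χ (new? A v w)) (bad v) ⟩
        ∑ (λ w → χ (new? A v w)) + ∑ (bad v) ≤⟨ +-monoʳ-≤ _ (∑-bad v s) ⟩
        ∑ (λ w → χ (new? A v w)) + L        ≡⟨ cong (∑ (λ w → χ (new? A v w)) +_) (≡-sym (+-identityʳ L)) ⟩
        ∑ (λ w → χ (new? A v w)) + 1 * L    ∎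

    -- A usable edge with a colour in A would already have put its end into `U A`, so the colour of
    -- a new edge is still among the undrawn ones.
    new≤Σgain : ∀ A R → (∀ v w → Edge G v w → col c v w ∈ A ⊎ col c v w ∈ R) →
      ∑ (λ w → ∑ (λ v → χ (new? A v w))) ≤ Σpick R (λ d _ → gain A d)
    new≤Σgain A R cover = begin
      ∑ (λ w → ∑ (λ v → χ (new? A v w)))
        ≤⟨ ∑-mono (λ w → ∑-mono (λ v → χ≤ (new? A v w) (picked v w))) ⟩
      ∑ (λ w → ∑ (λ v → Σpick R (λ d _ → χ (new? A v w ×-dec (col c v w ≟ d)))))
        ≡⟨ ∑-cong (λ w → ≡-sym (Σpick-∑ R (λ d v → χ (new? A v w ×-dec (col c v w ≟ d))))) ⟩
      ∑ (λ w → Σpick R (λ d _ → ∑ (λ v → χ (new? A v w ×-dec (col c v w ≟ d)))))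
        ≡⟨ ≡-sym (Σpick-∑ R (λ d w → ∑ (λ v → χ (new? A v w ×-dec (col c v w ≟ d))))) ⟩
      Σpick R (λ d _ → gain A d) ∎
      where
      open ≤-Reasoning
      picked : ∀ v w → New A v w → 1 ≤ Σpick R (λ d _ → χ (new? A v w ×-dec (col c v w ≟ d)))
      picked v w nw@(us , ¬i) with cover v w (usable-edge us)
      ... | inj₁ m = ⊥-elim (¬i (v , us , m))
      ... | inj₂ m = ≤-trans (1≤χ (new? A v w ×-dec (col c v w ≟ col c v w)) (nw , refl))
                             (Σpick-∈ (λ d → χ (new? A v w ×-dec (col c v w ≟ d))) m)

-- Inv r s: at size s, r further batches are enough to exceed N / 2; Big s u: u new vertices make a batch.
record Schedule {n : ℕ} (G : SimpleGraph n) (H : VSet n) (b : ℕ) : Set₁ where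
  field
    Inv     : ℕ → ℕ → Set
    Big     : ℕ → ℕ → Set
    big?    : ∀ s u → Dec (Big s u)
    active  : ∀ {r s} → Inv r s → 0 < s → ¬ (∣ H ∣ < 2 * s) → 0 < r
    advance : ∀ {r s u} → Inv (suc r) s → 0 < s → ¬ (∣ H ∣ < 2 * s) → Big s u → Inv r (s + u)
    small≤  : ∀ {s u} → 0 < s → ¬ (∣ H ∣ < 2 * s) → ¬ Big s u → u ≤ s
    expand  : ∀ {S S′ u} → S ⊑ S′ → S′ ⊑ H → 0 < ∣ S ∣ → ¬ (∣ H ∣ < 2 * ∣ S ∣) → ¬ Big ∣ S ∣ u →
              ∣ S′ ∣ ≡ ∣ S ∣ + u → b * ∣ S ∣ ≤ E G S (H ∖ˢ S′)

module Process {n : ℕ} {G : SimpleGraph n} (c : EdgeColouring G) (proper : Proper c)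
  (H : VSet n) (x : Fin n) (W : List (Fin n)) (F : List ℕ) (β ℓ K : ℕ)
  (sched : Schedule G H (β + (ℓ + length F + length W))) where

  open Schedule sched

  Finished : ℕ → Set
  Finished s = ∣ H ∣ < 2 * s

  -- The last condition exchanges batches for length: a batch uses up one unit of r and adds at most
  -- one edge, so trails never exceed ℓ.
  Good : List ℕ → ℕ → Fin n → List ℕ → Set
  Good A r v cs = ∃[ ws ] (Trail c x v ws cs × Unique cs × (∀ {d} → d ∈ cs → d ∈ A) × (∀ {d} → d ∈ cs → d ∉ F) ×
    (∀ {u} → u ∈ (v ∷ ws) → Avoids c x W u) × length cs + r ≤ ℓ)

  Good-⊆ : ∀ {A A′ r r′ v cs} → (∀ {d} → d ∈ A → d ∈ A′) → r′ ≤ r → Good A r v cs → Good A′ r′ v cs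
  Good-⊆ A⊆ r≤ (ws , t , u , a , f , av , l) = ws , t , u , (λ m → A⊆ (a m)) , f , av , ≤-trans (+-monoʳ-≤ _ r≤) l

  Reached : List ℕ → Set
  Reached A = ∃[ S ] (S ⊑ H × Finished ∣ S ∣ × (∀ v → S v ≡ true → ∃[ cs ] Good A 0 v cs))

  record State (r : ℕ) (A : List ℕ) : Set where
    field
      S       : VSet n
      S⊑H     : S ⊑ H
      nonempty : 0 < ∣ S ∣
      C       : Fin n → List ℕ
      good    : ∀ v → S v ≡ true → Good A r v (C v)
      inv     : Inv r ∣ S ∣

    open Batch c proper H S C W F public

    size : ℕ
    size = ∣ S ∣

  open State

  with-colour : ∀ {r A} d → State r A → State r (d ∷ A)
  with-colour d st = record
    { S = S st ; S⊑H = S⊑H st ; nonempty = nonempty st ; C = C st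
    ; good = λ v s → Good-⊆ there ≤-refl (good st v s) ; inv = inv st }

  finish : ∀ {r A} (cs : List ℕ) (st : State r A) → Finished (size st) → Reached (cs ʳ++ A)
  finish cs st fin = S st , S⊑H st , fin , λ v s → C st v , Good-⊆ (into cs) z≤n (good st v s)
    where
    into : ∀ cs {A d} → d ∈ A → d ∈ (cs ʳ++ A)
    into [] m = m
    into (_ ∷ cs) m = into cs (there m)

  absorb : ∀ {r A} (st : State (suc r) A) → ¬ Finished (size st) → Big (size st) ∣ U st A ∣ → State r A
  absorb {r} {A} st ¬fin big = record
    { S = S st ∪ˢ U st A
    ; S⊑H = S∪U⊑H st A (S⊑H st)
    ; nonempty = ≤-trans (nonempty st) (⊑⇒∣∣≤ (S⊑S∪U st A))
    ; C = λ w → pathTo w (is? (S st) w) (inU? st A w)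
    ; good = λ w p → good′ w p (is? (S st) w) (inU? st A w)
    ; inv = subst (Inv r) (≡-sym (∣∪∣-disjoint (S st) (U st A) (S∩U st A)))
              (advance (inv st) (nonempty st) ¬fin big)
    }
    where
    pathTo : ∀ w → Dec (S st w ≡ true) → Dec (InU st A w) → List ℕ
    pathTo w (yes _) _ = C st w
    pathTo w (no _) (yes (v , _)) = col c v w ∷ C st v
    pathTo w (no _) (no _) = []
    good′ : ∀ w → (S st ∪ˢ U st A) w ≡ true → (i : Dec (S st w ≡ true)) (j : Dec (InU st A w)) → Good A r w (pathTo w i j)
    good′ w p (yes s) _ = Good-⊆ (λ m → m) (n≤1+n r) (good st w s)
    good′ w p (no ¬s) (no ¬u) = case ∨⁻ p of λ where
      (inj₁ s) → ⊥-elim (¬s s)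
      (inj₂ u) → ⊥-elim (¬u (U⁻ st A u))
    good′ w p (no _) (yes (v , (sv , _ , _ , w∉W , e , d∉F , d∉C) , d∈A)) with good st v sv
    ... | ws , t , u , a , f , av , l =
      v ∷ ws , cons (Edge-sym G e) (≡-sym (colSym c v w e)) t , ¬Any⇒All¬ _ d∉C ∷ u
      , (λ { (here refl) → d∈A ; (there m) → a m })
      , (λ { (here refl) → d∉F ; (there m) → f m })
      , (λ { (here refl) → inj₂ w∉W ; (there m) → av m })
      , ≤-trans (≤-reflexive (≡-sym (+-suc (length (C st v)) r))) l

  Cover : List ℕ → List ℕ → Set
  Cover A R = ∀ v w → Edge G v w → col c v w ∈ A ⊎ col c v w ∈ R

  -- f acts as the number of draws before completion, truncated at T, so `f cs < T` certifies
  -- success.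
  Hit : ℕ → List ℕ → (List ℕ → ℕ) → Set
  Hit T A f = ∀ cs → length cs ≡ T → Reached (cs ʳ++ A) ⊎ T ≤ f cs

  -- Divided by the number of outcomes: the mean of f is at most 2rK / β.
  Weak : ℕ → ℕ → List ℕ → (List ℕ → ℕ) → Set
  Weak T r A f = ∀ R → Cover A R → length R ≤ K →
    β * Σdraws T R (λ cs _ → f cs) ≤ K * falling T (length R) * (2 * r)

  -- The potential 2r − |U| / |S|, which drops by at least β / K per draw in expectation, bounds the
  -- expected number of draws; cleared of denominators.
  Strong : ∀ T {r A} → State r A → (List ℕ → ℕ) → Set
  Strong T {r} {A} st f = ∀ R → Cover A R → length R ≤ K →
    β * size st * Σdraws T R (λ cs _ → f cs) + K * falling T (length R) * (∣ U st A ∣ ⊓ (2 * size st))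
      ≤ K * falling T (length R) * (2 * r * size st)

  cover-pick : ∀ {A R d R′} → Cover A R → Pick R d R′ → Cover (d ∷ A) R′
  cover-pick cov p v w e with cov v w e
  ... | inj₁ m = inj₁ (there m)
  ... | inj₂ m with Pick-split p m
  ... | inj₁ q = inj₁ (here q)
  ... | inj₂ m′ = inj₂ m′

  -- Sums the inductive bounds over the next colour. The draw adds 1 to f, and this is paid for by
  -- the mean gain of U, which is at least β|S| / |R| ≥ β|S| / K.
  strong-step : ∀ T {r A} (st : State r A) → ¬ Finished (size st) → ¬ Big (size st) ∣ U st A ∣ →
    (f : ℕ → List ℕ → ℕ) → (∀ d → Strong T (with-colour d st) (f d)) →
    (h : List ℕ → ℕ) → (∀ d cs → h (d ∷ cs) ≡ suc (f d cs)) → Strong (suc T) st h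
  strong-step T {r} {A} st ¬fin ¬big f ih h hd [] cov len = ≤-reflexive (lem β (size st) K _ _)
    where
    lem : ∀ β s K u v → β * s * 0 + K * 0 * u ≡ K * 0 * v
    lem = solve-∀
  strong-step T {r} {A} st ¬fin ¬big f ih h hd R@(_ ∷ R₀) cov len =
    +-cancelʳ-≤ (m * (β * s * t)) _ _ (begin
      β * s * Σh + K * (m * t) * (u ⊓ (2 * s)) + m * (β * s * t)
        ≤⟨ +-mono-≤ (+-monoʳ-≤ (β * s * Σh) (*-monoʳ-≤ (K * (m * t)) (m⊓n≤m u (2 * s)))) boundary ⟩
      β * s * Σh + K * (m * t) * u + K * t * Σa
        ≡⟨ e1 (β * s * Σh) K m t u Σa ⟩
      β * s * Σh + (K * t) * (m * u + Σa)
        ≡⟨ cong₂ (λ y z → y + (K * t) * z) (≡-sym (Σpick-*ˡ R (β * s) g))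
             (trans (cong (_+ Σa) (≡-sym (Σpick-const R u))) (≡-sym (Σpick-+ R (λ _ _ → u) (λ d _ → gain st A d)))) ⟩
      Σpick R (λ d R′ → β * s * g d R′) + (K * t) * Σpick R (λ d _ → u + gain st A d)
        ≡⟨ trans (cong (Σpick R (λ d R′ → β * s * g d R′) +_) (≡-sym (Σpick-*ˡ R (K * t) (λ d _ → u + gain st A d)))) (≡-sym (Σpick-+ R (λ d R′ → β * s * g d R′) (λ d _ → (K * t) * (u + gain st A d)))) ⟩
      Σpick R (λ d R′ → β * s * g d R′ + (K * t) * (u + gain st A d))
        ≤⟨ Σpick-mono R each ⟩
      Σpick R (λ _ _ → β * s * t + K * t * (2 * r * s))
        ≡⟨ Σpick-const R _ ⟩
      m * (β * s * t + K * t * (2 * r * s))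
        ≡⟨ e2 m (β * s * t) K t (2 * r * s) ⟩
      K * (m * t) * (2 * r * s) + m * (β * s * t) ∎)
    where
    open ≤-Reasoning
    s = size st
    u = ∣ U st A ∣
    m = length R
    t = falling T (length R₀)
    g : ℕ → List ℕ → ℕ
    g d R′ = Σdraws T R′ (λ cs _ → h (d ∷ cs))
    Σh = Σpick R g
    Σa = Σpick R (λ d _ → gain st A d)
    e1 : ∀ a K m t u b → a + K * (m * t) * u + K * t * b ≡ a + (K * t) * (m * u + b)
    e1 = solve-∀
    e2 : ∀ m b K t z → m * (b + K * t * z) ≡ K * (m * t) * z + m * b
    e2 = solve-∀
    e3 : ∀ m b t → m * (b * t) ≡ m * t * b
    e3 = solve-∀
    short : ∀ v → S st v ≡ true → length (C st v) ≤ ℓ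
    short v sv = m+n≤o⇒m≤o _ (proj₂ (proj₂ (proj₂ (proj₂ (proj₂ (proj₂ (good st v sv)))))))
    βs≤Σa : β * s ≤ Σa
    βs≤Σa = ≤-trans
      (new-lower st A {β} {ℓ} short
        (expand (S⊑S∪U st A) (S∪U⊑H st A (S⊑H st)) (nonempty st) ¬fin ¬big (∣∪∣-disjoint (S st) (U st A) (S∩U st A))))
      (new≤Σgain st A R cov)
    boundary : m * (β * s * t) ≤ K * t * Σa
    boundary = ≤-trans (≤-reflexive (e3 m (β * s) t)) (*-mono-≤ (*-monoˡ-≤ t len) βs≤Σa)
    each : ∀ {d R′} → Pick R d R′ → β * s * g d R′ + (K * t) * (u + gain st A d) ≤ β * s * t + K * t * (2 * r * s)
    each {d} {R′} p = begin
      β * s * g d R′ + (K * t) * (u + gain st A d)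
        ≡⟨ cong (λ z → β * s * z + (K * t) * (u + gain st A d)) gd ⟩
      β * s * (t + X) + (K * t) * (u + gain st A d)
        ≡⟨ cong (_+ (K * t) * (u + gain st A d)) (*-distribˡ-+ (β * s) t X) ⟩
      β * s * t + β * s * X + (K * t) * (u + gain st A d)
        ≡⟨ +-assoc (β * s * t) _ _ ⟩
      β * s * t + (β * s * X + (K * t) * (u + gain st A d))
        ≤⟨ +-monoʳ-≤ (β * s * t) (+-monoʳ-≤ (β * s * X) (*-monoʳ-≤ (K * t) grow)) ⟩
      β * s * t + (β * s * X + (K * t) * (∣ U st (d ∷ A) ∣ ⊓ (2 * s)))
        ≤⟨ +-monoʳ-≤ (β * s * t) ih′ ⟩
      β * s * t + K * t * (2 * r * s) ∎
      where
      X = Σdraws T R′ (λ cs _ → f d cs)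
      lenR′ : length R′ ≡ length R₀
      lenR′ = suc-injective (≡-sym (Pick-length p))
      gd : g d R′ ≡ t + X
      gd = trans (Σdraws-cong T (λ {cs} _ _ → hd d cs))
          (trans (Σdraws-+ T R′ (λ _ _ → 1) (λ cs _ → f d cs))
                 (cong (_+ X) (trans (Σdraws-const T R′ 1) (trans (*-identityʳ _) (cong (falling T) lenR′)))))
      ih′ : β * s * X + (K * t) * (∣ U st (d ∷ A) ∣ ⊓ (2 * s)) ≤ K * t * (2 * r * s)
      ih′ = subst (λ l → β * s * X + (K * falling T l) * (∣ U st (d ∷ A) ∣ ⊓ (2 * s)) ≤ K * falling T l * (2 * r * s))
              lenR′ (ih d R′ (cover-pick cov p) (≤-trans (≤-trans (≤-reflexive lenR′) (n≤1+n _)) len))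
      -- The cap 2|S| never cuts off a draw: U has at most |S| vertices because the batch is not
      -- big, and the drawn colour class, a matching, adds at most |S| more.
      grow : u + gain st A d ≤ ∣ U st (d ∷ A) ∣ ⊓ (2 * s)
      grow = ⊓-glb (gain-U st A d)
        (≤-trans (+-mono-≤ (small≤ (nonempty st) ¬fin ¬big) (gain≤∣S∣ st A d)) (≤-reflexive (cong (s +_) (≡-sym (+-identityʳ s)))))

  mutual
    weak : ∀ T r {A} → State r A → ∃[ f ] (Hit T A f × Weak T r A f)
    weak T r {A} st with ∣ H ∣ <? 2 * size st
    ... | yes fin = (λ _ → 0) , (λ cs _ → inj₁ (finish cs st fin)) , λ R _ _ →
          ≤-trans (≤-reflexive (trans (cong (β *_) (trans (Σdraws-const T R 0) (*-zeroʳ (falling T (length R))))) (*-zeroʳ β))) z≤n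
    ... | no ¬fin with strong T r st ¬fin
    ... | f , hit , bound = f , hit , λ R cov len →
          *-cancelʳ-≤ _ _ (size st) {{>-nonZero (nonempty st)}}
            (≤-trans (≤-reflexive (e1 β (size st) _))
              (≤-trans (m≤m+n _ _) (≤-trans (bound R cov len) (≤-reflexive (e2 (K * falling T (length R)) (2 * r) (size st))))))
      where
      e1 : ∀ a s y → a * y * s ≡ a * s * y
      e1 = solve-∀
      e2 : ∀ a b s → a * (b * s) ≡ a * b * s
      e2 = solve-∀

    -- The recursion ends because a draw lowers T and absorbing a batch lowers r; absorbing costs no
    -- draw.
    strong : ∀ T r {A} (st : State r A) → ¬ Finished (size st) → ∃[ f ] (Hit T A f × Strong T st f)
    strong T r {A} st ¬fin with big? (size st) ∣ U st A ∣
    strong T zero {A} st ¬fin | yes big = contradiction (active (inv st) (nonempty st) ¬fin) (λ ())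
    -- The cap is used here: the U term of the potential is at most 2, exactly what is released when
    -- r + 1 batches become r. The credit therefore covers emptying U and the change of |S|.
    strong T (suc r) {A} st ¬fin | yes big with weak T r (absorb st ¬fin big)
    ... | f , hit , bound = f , hit , λ R cov len → begin
          β * size st * Σdraws T R (λ cs _ → f cs) + K * falling T (length R) * (∣ U st A ∣ ⊓ (2 * size st))
            ≤⟨ +-mono-≤ (≤-reflexive (e1 β (size st) _)) (*-monoʳ-≤ (K * falling T (length R)) (m⊓n≤n ∣ U st A ∣ (2 * size st))) ⟩
          β * Σdraws T R (λ cs _ → f cs) * size st + K * falling T (length R) * (2 * size st)
            ≤⟨ +-monoˡ-≤ _ (*-monoˡ-≤ (size st) (bound R cov len)) ⟩
          K * falling T (length R) * (2 * r) * size st + K * falling T (length R) * (2 * size st)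
            ≡⟨ e2 (K * falling T (length R)) r (size st) ⟩
          K * falling T (length R) * (2 * suc r * size st) ∎
      where
      open ≤-Reasoning
      e1 : ∀ a s y → a * s * y ≡ a * y * s
      e1 = solve-∀
      e2 : ∀ a r s → a * (2 * r) * s + a * (2 * s) ≡ a * (2 * suc r * s)
      e2 = solve-∀
    -- With no draws left T ≤ f holds trivially, and the capped U term is covered because an
    -- unfinished state has r ≥ 1.
    strong zero r {A} st ¬fin | no ¬big = (λ _ → 0) , (λ _ _ → inj₂ z≤n) , λ R cov len → begin
          β * size st * 0 + K * 1 * (∣ U st A ∣ ⊓ (2 * size st)) ≡⟨ cong (_+ K * 1 * (∣ U st A ∣ ⊓ (2 * size st))) (*-zeroʳ (β * size st)) ⟩
          K * 1 * (∣ U st A ∣ ⊓ (2 * size st)) ≤⟨ *-monoʳ-≤ (K * 1) (m⊓n≤n ∣ U st A ∣ (2 * size st)) ⟩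
          K * 1 * (2 * size st)                ≤⟨ *-monoʳ-≤ (K * 1) (*-monoˡ-≤ (size st) (*-monoʳ-≤ 2 (active (inv st) (nonempty st) ¬fin))) ⟩
          K * 1 * (2 * r * size st) ∎
      where open ≤-Reasoning
    strong (suc T) r {A} st ¬fin | no ¬big = h , hit , strong-step T st ¬fin ¬big f (λ d → proj₂ (proj₂ (next d))) h (λ _ _ → refl)
      where
      next : ∀ d → ∃[ f ] (Hit T (d ∷ A) f × Strong T (with-colour d st) f)
      next d = strong T r (with-colour d st) ¬fin
      f : ℕ → List ℕ → ℕ
      f d = proj₁ (next d)
      h : List ℕ → ℕ
      h [] = 0
      h (d ∷ cs) = suc (f d cs)
      hit : Hit (suc T) A h
      hit (d ∷ cs) q with proj₁ (proj₂ (next d)) cs (suc-injective q)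
      ... | inj₁ reached = inj₁ reached
      ... | inj₂ le = inj₂ (s≤s le)

  start : H x ≡ true → Inv ℓ 1 → State ℓ []
  start hx inv₁ = record
    { S = λ v → does (v Fin.≟ x)
    ; S⊑H = λ v p → subst (λ w → H w ≡ true) (≡-sym (does⁻ (v Fin.≟ x) p)) hx
    ; nonempty = ≤-reflexive (≡-sym one)
    ; C = λ _ → []
    ; good = λ v p → start-good (does⁻ (v Fin.≟ x) p)
    ; inv = subst (Inv ℓ) (≡-sym one) inv₁
    }
    where
    one : ∣ (λ v → does (v Fin.≟ x)) ∣ ≡ 1
    one = ≤-antisym (∑-χ≤1 (Fin._≟ x) (λ p q → trans p (≡-sym q)))
                    (1≤∣∣ {X = λ v → does (v Fin.≟ x)} {x} (does⁺ (x Fin.≟ x) refl))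
    start-good : ∀ {v} → v ≡ x → Good [] ℓ v []
    start-good refl = [] , nil , [] , (λ ()) , (λ ()) , (λ { (here q) → inj₁ q }) , ≤-refl

-- Joining two vertices by a rainbow path

module _ {n : ℕ} {G : SimpleGraph n} (c : EdgeColouring G) (proper : Proper c) where

  -- With K = 2T colours each endpoint needs at most 4ℓT / β draws in the mean. The two means add up
  -- to less than T exactly when 8ℓ < β, whatever T is.
  connect : ∀ {H : VSet n} {W F β ℓ T x y} (sched : Schedule G H (β + (ℓ + length F + length W))) →
    Schedule.Inv sched ℓ 1 → 8 * ℓ < β → 0 < T → (∀ u v → Edge G u v → col c u v < T + T) →
    H x ≡ true → H y ≡ true → x ≢ y → Link c x y W F (ℓ + ℓ)
  connect {H} {W} {F} {β} {ℓ} {T} {x} {y} sched inv₁ 8ℓ<β 0<T bounded hx hy x≢y =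
    result (X.weak T ℓ (X.start hx inv₁)) (Y.weak T ℓ (Y.start hy inv₁))
    where
    module X = Process c proper H x W F β ℓ (T + T) sched
    module Y = Process c proper H y W F β ℓ (T + T) sched
    palette = upTo (T + T)
    len-palette = length-upTo (T + T)
    cover : ∀ v w → Edge G v w → col c v w ∈ [] ⊎ col c v w ∈ palette
    cover v w e = inj₂ (∈-upTo⁺ (bounded v w e))
    B = (T + T) * (2 * ℓ)
    e1 : ∀ K t z → K * t * z ≡ K * z * t
    e1 = solve-∀
    shape : ∀ {z} → z ≤ (T + T) * falling T (length palette) * (2 * ℓ) → z ≤ B * falling T (T + T)
    shape {z} p = ≤-trans p (≤-reflexive (trans (cong (λ l → (T + T) * falling T l * (2 * ℓ)) len-palette) (e1 (T + T) _ (2 * ℓ))))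
    e2 : ∀ T ℓ → 2 * ((T + T) * (2 * ℓ)) ≡ 8 * ℓ * T
    e2 = solve-∀
    enough : 2 * B < β * T
    enough = ≤-<-trans (≤-reflexive (e2 T ℓ)) (*-monoˡ-< T {{>-nonZero 0<T}} 8ℓ<β)
    ʳ++⁻ : ∀ cs {A : List ℕ} {d} → d ∈ (cs ʳ++ A) → d ∈ cs ⊎ d ∈ A
    ʳ++⁻ [] m = inj₂ m
    ʳ++⁻ (_ ∷ cs) m with ʳ++⁻ cs m
    ... | inj₁ i = inj₁ (there i)
    ... | inj₂ (here q) = inj₁ (here q)
    ... | inj₂ (there i) = inj₂ i
    from-rev : ∀ cs {d : ℕ} → d ∈ (cs ʳ++ []) → d ∈ cs
    from-rev cs m with ʳ++⁻ cs m
    ... | inj₁ i = i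
    join : ∀ {a b R′ R″} → Draws palette a R′ → Draws R′ b R″ → X.Reached (a ʳ++ []) → Y.Reached (b ʳ++ []) → Link c x y W F (ℓ + ℓ)
    join {a} {b} da db (S , S⊑H , bigS , goodS) (S′ , S′⊑H , bigS′ , goodS′)
      with meet S⊑H S′⊑H (*-cancelˡ-< 2 _ _ (subst₂ _<_ (cong (∣ H ∣ +_) (≡-sym (+-identityʳ ∣ H ∣)))
              (≡-sym (*-distribˡ-+ 2 ∣ S ∣ ∣ S′ ∣)) (+-mono-< bigS bigS′)))
    ... | z , zS , zS′ with goodS z zS | goodS′ z zS′
    ... | cs , ws , t , u , inA , notF , av , l | ds , vs , t′ , u′ , inA′ , notF′ , av′ , l′ =
      link c x≢y t t′ u u′
        (λ m m′ → Draws-disjoint (upTo⁺ (T + T)) da (from-rev a (inA m)) (Draws-∈ db (from-rev b (inA′ m′))))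
        av (λ m → av′ (there m)) notF notF′ (m+n≤o⇒m≤o _ l) (m+n≤o⇒m≤o _ l′)
    conclude : ∀ {f g a b R′ R″} → X.Hit T [] f → Y.Hit T [] g → Draws palette a R′ → Draws R′ b R″ →
      length a ≡ T → length b ≡ T → f a < T → g b < T → Link c x y W F (ℓ + ℓ)
    conclude {a = a} {b} hitX hitY da db la lb fa gb with hitX a la | hitY b lb
    ... | inj₂ T≤ | _ = contradiction fa (≤⇒≯ T≤)
    ... | inj₁ _ | inj₂ T≤ = contradiction gb (≤⇒≯ T≤)
    ... | inj₁ rx | inj₁ ry = join da db rx ry
    result : ∃[ f ] (X.Hit T [] f × X.Weak T ℓ [] f) → ∃[ g ] (Y.Hit T [] g × Y.Weak T ℓ [] g) → Link c x y W F (ℓ + ℓ)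
    result (f , hitX , weakX) (g , hitY , weakY) =
      let a , b , R′ , R″ , da , db , la , lb , fa , gb =
            two-draws T palette f g {β} {B} len-palette (shape (weakX palette cover (≤-reflexive len-palette))) (shape (weakY palette cover (≤-reflexive len-palette))) enough
      in conclude hitX hitY da db la lb fa gb

-- The batch schedule of a densest subgraph

harmonic-monoˡ : ∀ {M M′} k → M ≤ M′ → harmonic M k ≤ harmonic M′ k
harmonic-monoˡ zero p = z≤n
harmonic-monoˡ (suc k) p = +-mono-≤ (harmonic-monoˡ k p) (+-monoˡ-≤ 1 (/-monoˡ-≤ (suc k) p))

module _ {n : ℕ} (G : SimpleGraph n) (Λ : ℕ) (0<Λ : 0 < Λ) where

  weight : ℕ → ℕ
  weight m = Λ + lev m

  weight-mono : ∀ {a b} → a ≤ b → weight a ≤ weight b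
  weight-mono p = +-monoʳ-≤ Λ (lev-mono p)

  module Batches {H : VSet n} (H≠∅ : 0 < ∣ H ∣) (lev≤Λ : lev ∣ H ∣ ≤ Λ) where

    N = ∣ H ∣
    φN = weight N
    M = 4 * φN

    level : ℕ → ℕ
    level s = lev N ∸ lev s

    -- s₀ is the size at which the current level was entered and j the number of batches since. Each
    -- of them added at least the fraction `level s / M` of s₀, and they are credited against the
    -- harmonic budget.
    Inv : ℕ → ℕ → Set
    Inv r s = ∃[ s₀ ] ∃[ j ] (0 < s₀ × lev s₀ ≡ lev s × s₀ * (M + j * level s) ≤ M * s × harmonic M (level s) ≤ r + j)

    -- M = 4φN is chosen so that a waiting set below this threshold, at weight at most φN per
    -- vertex, costs less than `level s / 4` per vertex of S.
    Big : ℕ → ℕ → Set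
    Big s u = level s * s ≤ M * u

    0<φN : 0 < φN
    0<φN = ≤-trans 0<Λ (m≤m+n Λ _)

    0<M : 0 < M
    0<M = *-mono-< {0} {4} (s≤s z≤n) 0<φN

    M≤8Λ : M ≤ 8 * Λ
    M≤8Λ = ≤-trans (*-monoʳ-≤ 4 (+-monoʳ-≤ Λ lev≤Λ)) (≤-reflexive (e Λ))
      where
      e : ∀ L → 4 * (L + L) ≡ 8 * L
      e = solve-∀

    -- The bound M ≤ 8Λ frees the budget from H, so the length ℓ can be fixed from n alone.
    inv-start : Inv (harmonic (8 * Λ) Λ) 1
    inv-start = 1 , 0 , s≤s z≤n , refl , ≤-reflexive (e M)
      , ≤-trans (≤-trans (harmonic-mono M (≤-trans (m∸n≤m (lev N) (lev 1)) lev≤Λ)) (harmonic-monoˡ Λ M≤8Λ)) (m≤m+n _ 0)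
      where
      e : ∀ M → 1 * (M + 0) ≡ M * 1
      e = solve-∀

    unfinished-level : ∀ {s} → 0 < s → ¬ (N < 2 * s) → ∃[ k ] (level s ≡ 2 + k)
    unfinished-level {s} 0<s ¬fin = level s ∸ 2 , ≡-sym (m+[n∸m]≡n lvl≥2)
      where
      lvl≥2 : 2 ≤ level s
      lvl≥2 = m+n≤o⇒m≤o∸n 2 (≰⇒> (λ p → ¬fin (lev-near-top H≠∅ 0<s p)))

    -- Within one level the size less than doubles, so j · `level s` < M. The quotient M / `level s`
    -- thus covers all j batches spent there, and the `+ 1` of that harmonic term is still
    -- available.
    spare : ∀ {r s} → Inv r s → 0 < s → ¬ (N < 2 * s) → harmonic M (level s ∸ 1) < r
    spare {r} {s} (s₀ , j , 0<s₀ , same , grown , budget) 0<s ¬fin with unfinished-level 0<s ¬fin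
    ... | k , eq rewrite eq = +-cancelʳ-≤ (M / suc (suc k)) _ _ (begin
        suc (harmonic M (suc k)) + M / suc (suc k)   ≡⟨ e1 (harmonic M (suc k)) _ ⟩
        harmonic M (suc k) + (M / suc (suc k) + 1)   ≤⟨ budget ⟩
        r + j                                        ≤⟨ +-monoʳ-≤ r j≤ ⟩
        r + M / suc (suc k)                          ∎)
      where
      open ≤-Reasoning
      e1 : ∀ a b → suc a + b ≡ a + (b + 1)
      e1 = solve-∀
      e2 : ∀ M s → M * (2 * s) ≡ s * (M + M)
      e2 = solve-∀
      jk<M : j * suc (suc k) < M
      jk<M = +-cancelˡ-< M _ _ (*-cancelˡ-< s₀ _ _ (begin-strict
        s₀ * (M + j * suc (suc k))  ≤⟨ grown ⟩
        M * s                       <⟨ *-monoʳ-< M {{>-nonZero 0<M}} (lev-same⇒<2* 0<s 0<s₀ (≡-sym same)) ⟩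
        M * (2 * s₀)                ≡⟨ e2 M s₀ ⟩
        s₀ * (M + M)                ∎))
      j≤ : j ≤ M / suc (suc k)
      j≤ = subst (_≤ M / suc (suc k)) (m*n/n≡m j (suc (suc k))) (/-monoˡ-≤ (suc (suc k)) (<⇒≤ jk<M))

    advance : ∀ {r s u} → Inv (suc r) s → 0 < s → ¬ (N < 2 * s) → Big s u → Inv r (s + u)
    advance {r} {s} {u} inv@(s₀ , j , 0<s₀ , same , grown , budget) 0<s ¬fin big with m≤n⇒m<n∨m≡n (lev-mono (m≤m+n s u))
    ... | inj₂ eq = s₀ , suc j , 0<s₀ , trans same eq , subst (λ l → s₀ * (M + suc j * (lev N ∸ l)) ≤ M * (s + u)) eq grown′
                  , subst (λ l → harmonic M (lev N ∸ l) ≤ r + suc j) eq (≤-trans budget (≤-reflexive (≡-sym (+-suc r j))))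
      where
      open ≤-Reasoning
      s₀≤s : s₀ ≤ s
      s₀≤s = *-cancelˡ-≤ M {{>-nonZero 0<M}} (≤-trans (≤-reflexive (*-comm M s₀)) (≤-trans (*-monoʳ-≤ s₀ (m≤m+n M _)) grown))
      e1 : ∀ s₀ M j k → s₀ * (M + suc j * k) ≡ s₀ * (M + j * k) + k * s₀
      e1 = solve-∀
      grown′ : s₀ * (M + suc j * level s) ≤ M * (s + u)
      grown′ = begin
        s₀ * (M + suc j * level s)                ≡⟨ e1 s₀ M j (level s) ⟩
        s₀ * (M + j * level s) + level s * s₀     ≤⟨ +-mono-≤ grown (≤-trans (*-monoʳ-≤ (level s) s₀≤s) big) ⟩
        M * s + M * u                             ≡⟨ ≡-sym (*-distribˡ-+ M s u) ⟩
        M * (s + u)                               ∎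
    -- A new level is entered: the record restarts at s + u with j = 0, and the spare batch of the
    -- old level is spent.
    ... | inj₁ up = s + u , 0 , ≤-trans 0<s (m≤m+n s u) , refl , ≤-reflexive (e1 (s + u) M)
                  , ≤-trans (harmonic-mono M level-drop) (≤-trans (s≤s⁻¹ (spare inv 0<s ¬fin)) (m≤m+n r 0))
      where
      e1 : ∀ s M → s * (M + 0) ≡ M * s
      e1 = solve-∀
      level-drop : level (s + u) ≤ level s ∸ 1
      level-drop = ≤-trans (∸-monoʳ-≤ (lev N) up)
        (≤-reflexive (trans (cong (lev N ∸_) (+-comm 1 (lev s))) (≡-sym (∸-+-assoc (lev N) (lev s) 1))))

    small : ∀ {s u} → ¬ Big s u → 4 * u ≤ s
    small {s} {u} ¬big = <⇒≤ (*-cancelˡ-< φN _ _ (begin-strict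
      φN * (4 * u)       ≡⟨ e φN u ⟩
      M * u              <⟨ ≰⇒> ¬big ⟩
      level s * s        ≤⟨ *-monoˡ-≤ s (≤-trans (m∸n≤m (lev N) (lev s)) (m≤n+m (lev N) Λ)) ⟩
      φN * s             ∎))
      where
      open ≤-Reasoning
      e : ∀ f u → f * (4 * u) ≡ 4 * f * u
      e = solve-∀

    schedule : ∀ {b} → Densest G (λ m → m * weight m) H → N * (8 * (Λ * b)) ≤ D G H → Schedule G H b
    schedule {b} den dense = record
      { Inv = Inv ; Big = Big
      ; big? = λ s u → level s * s ≤? M * u
      ; active = λ inv 0<s ¬fin → ≤-<-trans z≤n (spare inv 0<s ¬fin)
      ; advance = advance
      ; small≤ = λ {s} {u} _ _ ¬big → ≤-trans (m≤m+n u _) (small {s} {u} ¬big)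
      ; expand = expand
      }
      where
      open Expansion G weight weight-mono H H≠∅ den using (expansion)
      expand : ∀ {S S′ u} → S ⊑ S′ → S′ ⊑ H → 0 < ∣ S ∣ → ¬ (∣ H ∣ < 2 * ∣ S ∣) → ¬ Big ∣ S ∣ u →
               ∣ S′ ∣ ≡ ∣ S ∣ + u → b * ∣ S ∣ ≤ E G S (H ∖ˢ S′)
      expand {S} {S′} {u} S⊑S′ S′⊑H 0<S ¬fin ¬big eq with unfinished-level 0<S ¬fin
      ... | k , lv = expansion {k = 2 + k} S⊑S′ S′⊑H
            (subst (λ s′ → 4 * (s′ * weight s′) + (2 + k) * s ≤ 4 * (s * φN)) (≡-sym eq) slack) dense rate 0<φN
        where
        open ≤-Reasoning
        s = ∣ S ∣
        -- φN ≤ 2Λ, and the factor 2 is made up by the level being at least 2.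
        rate : 8 * (φN * b) ≤ 8 * (Λ * b) * (2 + k)
        rate = begin
          8 * (φN * b)            ≤⟨ *-monoʳ-≤ 8 (*-monoˡ-≤ b (+-monoʳ-≤ Λ lev≤Λ)) ⟩
          8 * ((Λ + Λ) * b)       ≡⟨ e Λ b ⟩
          8 * (Λ * b) * 2         ≤⟨ *-monoʳ-≤ (8 * (Λ * b)) (m≤m+n 2 k) ⟩
          8 * (Λ * b) * (2 + k)   ∎
          where
          e : ∀ L b → 8 * ((L + L) * b) ≡ 8 * (L * b) * 2
          e = solve-∀
        levels : lev s + (2 + k) ≡ lev N
        levels = trans (cong (lev s +_) (≡-sym lv)) (m+[n∸m]≡n (<⇒≤ (m<n⇒lt lv)))
          where
          m<n⇒lt : level s ≡ 2 + k → lev s < lev N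
          m<n⇒lt q = m∸n≢0⇒n<m (λ z → 0≢1+n (trans (≡-sym z) q))
        φ′ = weight (s + u)
        lev-s′ : lev (s + u) ≤ suc (lev s)
        lev-s′ = lev-step 0<S (m≤m+n s u) (≤-trans (≤-reflexive (*-distribˡ-+ 4 s u))
                   (≤-trans (+-monoʳ-≤ (4 * s) (small {s} {u} ¬big)) (≤-reflexive (+-comm (4 * s) s))))
        -- A waiting set that is not big raises the level of S by at most one, so a distance of at
        -- least 1 + k to the top remains, which is at least (2 + k) / 2.
        weights : 2 * φ′ + (2 + k) ≤ 2 * φN
        weights = begin
          2 * (Λ + lev (s + u)) + (2 + k)   ≤⟨ +-monoˡ-≤ (2 + k) (*-monoʳ-≤ 2 (+-monoʳ-≤ Λ lev-s′)) ⟩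
          2 * (Λ + suc (lev s)) + (2 + k)   ≤⟨ m≤m+n _ k ⟩
          2 * (Λ + suc (lev s)) + (2 + k) + k ≡⟨ e Λ (lev s) k ⟩
          2 * (Λ + (lev s + (2 + k)))       ≡⟨ cong (λ z → 2 * (Λ + z)) levels ⟩
          2 * φN                            ∎
          where
          e : ∀ L l k → 2 * (L + suc l) + (2 + k) + k ≡ 2 * (L + (l + (2 + k)))
          e = solve-∀
        few : 4 * φN * u ≤ (2 + k) * s
        few = subst (λ z → M * u ≤ z * s) lv (<⇒≤ (≰⇒> ¬big))
        φ′≤φN : φ′ ≤ φN
        φ′≤φN = *-cancelˡ-≤ 2 (≤-trans (m≤m+n _ (2 + k)) weights)
        -- The weight gap is worth 2(2 + k) per vertex of S: one half pays for the u waiting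
        -- vertices, the other is the slack that `expansion` asks for.
        slack : 4 * ((s + u) * φ′) + (2 + k) * s ≤ 4 * (s * φN)
        slack = begin
          4 * ((s + u) * φ′) + (2 + k) * s             ≡⟨ e1 s u φ′ ((2 + k) * s) ⟩
          4 * (s * φ′) + 4 * φ′ * u + (2 + k) * s      ≤⟨ +-monoˡ-≤ ((2 + k) * s) (+-monoʳ-≤ (4 * (s * φ′)) (≤-trans (*-monoˡ-≤ u (*-monoʳ-≤ 4 φ′≤φN)) few)) ⟩
          4 * (s * φ′) + (2 + k) * s + (2 + k) * s     ≡⟨ e2 s φ′ (2 + k) ⟩
          2 * s * (2 * φ′ + (2 + k))                   ≤⟨ *-monoʳ-≤ (2 * s) weights ⟩
          2 * s * (2 * φN)                             ≡⟨ e3 s φN ⟩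
          4 * (s * φN)                                 ∎
          where
          e1 : ∀ s u f z → 4 * ((s + u) * f) + z ≡ 4 * (s * f) + 4 * f * u + z
          e1 = solve-∀
          e2 : ∀ s f k → 4 * (s * f) + k * s + k * s ≡ 2 * s * (2 * f + k)
          e2 = solve-∀
          e3 : ∀ s f → 2 * s * (2 * f) ≡ 4 * (s * f)
          e3 = solve-∀

-- Greedy embedding

pairs : ∀ t → List (Fin t × Fin t)
pairs t = cartesianProduct (allFin t) (allFin t)

module Greedy {n t : ℕ} {G : SimpleGraph n} (c : EdgeColouring G) (branch : Fin t → Fin n)
  (branch-inj : Injective _≡_ _≡_ branch) (m : ℕ)
  (links : ∀ W F → length W ≤ t + length (pairs t) * m → length F ≤ length (pairs t) * m → ∀ i j → i ≢ j → Link c (branch i) (branch j) W F m)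
  where

  private
    V = Fin n
    Pair = Fin t × Fin t

    _≟ₚ_ : (p q : Pair) → Dec (p ≡ q)
    _≟ₚ_ = ≡-dec Fin._≟_ Fin._≟_

    walk : Pair → List V → List V
    walk (i , j) is = branch i ∷ is ++ [ branch j ]

    Ordered : Pair → Set
    Ordered (i , j) = i <ᶠ j

  record PathOK (p : Pair) (is : List V) : Set where
    field
      isWalk  : IsWalk G (walk p is)
      unique  : Unique is
      noBranch : ∀ k → ¬ branch k ∈ is
      rainbow : Unique (walkColours c (walk p is))

  record Apart (p q : Pair) (is js : List V) : Set where
    field
      vertices : Disjoint is js
      colours  : Disjoint (walkColours c (walk p is)) (walkColours c (walk q js))

  -- The used lists are all that the next link has to avoid: they hold the branch vertices and
  -- everything on earlier paths. Pairs out of order carry no path but are counted in the length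
  -- bounds.
  record Embedded (ps : List Pair) : Set where
    field
      inner   : Pair → List V
      ok      : ∀ {p} → p ∈ ps → Ordered p → PathOK p (inner p)
      apart   : ∀ {p q} → p ∈ ps → q ∈ ps → Ordered p → Ordered q → p ≢ q → Apart p q (inner p) (inner q)
      usedV   : List V
      usedC   : List ℕ
      usedV≤  : length usedV ≤ t + length ps * m
      usedC≤  : length usedC ≤ length ps * m
      branch∈ : ∀ k → branch k ∈ usedV
      inner∈  : ∀ {p v} → p ∈ ps → Ordered p → v ∈ inner p → v ∈ usedV
      colour∈ : ∀ {p d} → p ∈ ps → Ordered p → d ∈ walkColours c (walk p (inner p)) → d ∈ usedC

  open Embedded

  empty : Embedded []
  empty = record
    { inner = λ _ → [] ; ok = λ () ; apart = λ ()
    ; usedV = tabulate branch ; usedC = []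
    ; usedV≤ = ≤-reflexive (trans (length-tabulate branch) (≡-sym (+-identityʳ t))) ; usedC≤ = z≤n
    ; branch∈ = ∈-tabulate⁺ ; inner∈ = λ () ; colour∈ = λ () }

  skip : ∀ {p ps} → ¬ Ordered p → Embedded ps → Embedded (p ∷ ps)
  skip {p} {ps} ¬o emb = record
    { inner = inner emb
    ; ok = λ m o → ok emb (old m o) o
    ; apart = λ m m′ o o′ ne → apart emb (old m o) (old m′ o′) o o′ ne
    ; usedV = usedV emb ; usedC = usedC emb
    ; usedV≤ = ≤-trans (usedV≤ emb) (+-monoʳ-≤ t (m≤n+m _ m)) ; usedC≤ = ≤-trans (usedC≤ emb) (m≤n+m _ m)
    ; branch∈ = branch∈ emb
    ; inner∈ = λ m o → inner∈ emb (old m o) o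
    ; colour∈ = λ m o → colour∈ emb (old m o) o }
    where
    old : ∀ {q} → q ∈ (p ∷ ps) → Ordered q → q ∈ ps
    old (here refl) o = ⊥-elim (¬o o)
    old (there i) _ = i

  extend : ∀ {p ps} (emb : Embedded ps) → Link c (branch (proj₁ p)) (branch (proj₂ p)) (usedV emb) (usedC emb) m →
    Embedded (p ∷ ps)
  extend {p} {ps} emb l = record
    { inner = inner′
    ; ok = λ {q} m o → ok′ q m o (q ≟ₚ p)
    ; apart = λ {q} {r} m m′ o o′ ne → apart′ q r m m′ o o′ ne (q ≟ₚ p) (r ≟ₚ p)
    ; usedV = L.inner ++ usedV emb ; usedC = newC ++ usedC emb
    ; usedV≤ = ≤-trans (≤-reflexive (length-++ L.inner)) (≤-trans (+-mono-≤ L.inner≤ (usedV≤ emb)) (≤-reflexive (e m t (length ps * m))))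
    ; usedC≤ = ≤-trans (≤-reflexive (length-++ newC)) (+-mono-≤ L.colours≤ (usedC≤ emb))
    ; branch∈ = λ k → ∈-++⁺ʳ L.inner (branch∈ emb k)
    ; inner∈ = λ {q} m o → inner∈′ q m o (q ≟ₚ p)
    ; colour∈ = λ {q} m o → colour∈′ q m o (q ≟ₚ p) }
    where
    module L = Link l
    e : ∀ a b c → a + (b + c) ≡ b + (a + c)
    e = solve-∀
    newC = walkColours c (walk p L.inner)
    update : (q : Pair) → Dec (q ≡ p) → List V
    update q (yes _) = L.inner
    update q (no _) = inner emb q
    inner′ : Pair → List V
    inner′ q = update q (q ≟ₚ p)
    old : ∀ {q} → q ≢ p → q ∈ (p ∷ ps) → q ∈ ps
    old ne (here q) = ⊥-elim (ne q)
    old ne (there i) = i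
    ok′ : ∀ q → q ∈ (p ∷ ps) → Ordered q → (d : Dec (q ≡ p)) → PathOK q (update q d)
    ok′ q _ _ (yes refl) = record { isWalk = L.walk-ok ; unique = L.unique
                                  ; noBranch = λ k i → L.avoidsV i (branch∈ emb k) ; rainbow = L.rainbow }
    ok′ q i o (no ne) = ok emb (old ne i) o
    apart′ : ∀ q r → q ∈ (p ∷ ps) → r ∈ (p ∷ ps) → Ordered q → Ordered r → q ≢ r →
      (d : Dec (q ≡ p)) (d′ : Dec (r ≡ p)) → Apart q r (update q d) (update r d′)
    apart′ q r _ _ _ _ ne (yes refl) (yes refl) = ⊥-elim (ne refl)
    apart′ q r _ i _ o ne (yes refl) (no nr) = record
      { vertices = λ a b → L.avoidsV a (inner∈ emb (old nr i) o b)
      ; colours = λ a b → L.avoidsC a (colour∈ emb (old nr i) o b) }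
    apart′ q r i _ o _ ne (no nq) (yes refl) = record
      { vertices = λ a b → L.avoidsV b (inner∈ emb (old nq i) o a)
      ; colours = λ a b → L.avoidsC b (colour∈ emb (old nq i) o a) }
    apart′ q r i j o o′ ne (no nq) (no nr) = apart emb (old nq i) (old nr j) o o′ ne
    inner∈′ : ∀ q {v} → q ∈ (p ∷ ps) → Ordered q → (d : Dec (q ≡ p)) → v ∈ update q d → v ∈ (L.inner ++ usedV emb)
    inner∈′ q _ _ (yes _) a = ∈-++⁺ˡ a
    inner∈′ q i o (no ne) a = ∈-++⁺ʳ L.inner (inner∈ emb (old ne i) o a)
    colour∈′ : ∀ q {k} → q ∈ (p ∷ ps) → Ordered q → (d : Dec (q ≡ p)) → k ∈ walkColours c (walk q (update q d)) → k ∈ (newC ++ usedC emb)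
    colour∈′ q _ _ (yes refl) a = ∈-++⁺ˡ a
    colour∈′ q i o (no ne) a = ∈-++⁺ʳ newC (colour∈ emb (old ne i) o a)

  embed : ∀ ps → length ps ≤ length (pairs t) → Embedded ps
  embed [] _ = empty
  embed (p@(i , j) ∷ ps) len with i Fin.<? j
  ... | no ¬o = skip ¬o (embed ps (<⇒≤ len))
  ... | yes o = extend emb (links (usedV emb) (usedC emb)
        (≤-trans (usedV≤ emb) (+-monoʳ-≤ t short)) (≤-trans (usedC≤ emb) short) i j (Fin.<⇒≢ o))
    where
    emb = embed ps (<⇒≤ len)
    short : length ps * m ≤ length (pairs t) * m
    short = *-monoˡ-≤ m (<⇒≤ len)

  rainbowTK : RainbowTK G c t
  rainbowTK = record
    { branch = branch
    ; branchInj = branch-inj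
    ; internal = λ i j → inner emb (i , j)
    ; isWalk = λ i j o → PathOK.isWalk (ok emb (all i j) o)
    ; intUnique = λ i j o → PathOK.unique (ok emb (all i j) o)
    ; intNotBr = λ i j o → PathOK.noBranch (ok emb (all i j) o)
    ; intDisj = λ i j k l o o′ ne → Apart.vertices (apart emb (all i j) (all k l) o o′ (ne ∘ λ q → cong proj₁ q , cong proj₂ q))
    ; rainbowIn = λ i j o → PathOK.rainbow (ok emb (all i j) o)
    ; rainbowOut = λ i j k l o o′ ne → Apart.colours (apart emb (all i j) (all k l) o o′ (ne ∘ λ q → cong proj₁ q , cong proj₂ q))
    }
    where
    emb = embed (pairs t) ≤-refl
    all : ∀ i j → (i , j) ∈ pairs t
    all i j = ∈-cartesianProduct⁺ (∈-allFin i) (∈-allFin j)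

-- Choice of constants and the final estimate

pathBound : ℕ → ℕ
pathBound Λ = harmonic (8 * Λ) Λ

boundary : ℕ → ℕ → ℕ
boundary t ℓ = suc (8 * ℓ) + (ℓ + length (pairs t) * (ℓ + ℓ) + (t + length (pairs t) * (ℓ + ℓ)))

dense⇒rainbowTK : ∀ {n} (t : ℕ) (G : SimpleGraph n) (c : EdgeColouring G) → Proper c → 0 < n → 0 < lev n →
  n * (2 * (8 * (lev n * boundary t (pathBound (lev n))))) ≤ degSum G → RainbowTK G c t
dense⇒rainbowTK {n} t G c proper 0<n 0<Λ dense = build (densest-subset G w full 0<full)
  where
  Λ = lev n
  ℓ = pathBound Λ
  b = boundary t ℓ
  κ = length (pairs t)
  w : ℕ → ℕ
  w m = m * weight G Λ 0<Λ m
  full : VSet n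
  full _ = true
  ∣full∣ : ∣ full ∣ ≡ n
  ∣full∣ = trans (∑-const {n} 1) (*-identityʳ n)
  0<full : 0 < ∣ full ∣
  0<full = subst (0 <_) (≡-sym ∣full∣) 0<n
  -- Any bound on the colours will do, since T cancels in `connect`.
  T = suc (∑ (λ u → ∑ (col c u)))
  bounded : ∀ u v → Edge G u v → col c u v < T + T
  bounded u v _ = ≤-trans (s≤s (≤-trans (≤∑ (col c u) v) (≤∑ (λ u → ∑ (col c u)) u))) (m≤m+n T T)
  build : ∃[ H ] (0 < ∣ H ∣ × D G full * w ∣ H ∣ ≤ D G H * w ∣ full ∣ × Densest G w H) → RainbowTK G c t
  build (H , 0<H , ratio , den) = Greedy.rainbowTK c branch (proj₂ (proj₂ chosen)) (ℓ + ℓ) links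
    where
    N = ∣ H ∣
    N≤n : N ≤ n
    N≤n = ≤-trans (⊑⇒∣∣≤ {X = H} {full} (λ _ _ → refl)) (≤-reflexive ∣full∣)
    module B = Batches G Λ 0<Λ {H} 0<H (lev-mono N≤n)
    open ≤-Reasoning
    -- The weight is 2Λ at n and at least Λ at N, so maximality of H costs a factor 2; the leading 2
    -- in the density hypothesis provides it.
    dense-H : N * (8 * (Λ * b)) ≤ D G H
    dense-H = *-cancelˡ-≤ (n * 2 * Λ) {{m*n≢0 (n * 2) Λ {{m*n≢0 n 2 {{>-nonZero 0<n}}}} {{>-nonZero 0<Λ}}}} (begin
      n * 2 * Λ * (N * (8 * (Λ * b)))   ≡⟨ e1 n Λ N (8 * (Λ * b)) ⟩
      n * (2 * (8 * (Λ * b))) * (N * Λ) ≤⟨ *-monoˡ-≤ (N * Λ) dense ⟩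
      degSum G * (N * Λ)                ≤⟨ *-monoʳ-≤ (degSum G) (*-monoʳ-≤ N (m≤m+n Λ (lev N))) ⟩
      degSum G * w N                    ≤⟨ ratio ⟩
      D G H * w ∣ full ∣                ≡⟨ cong (λ z → D G H * w z) ∣full∣ ⟩
      D G H * (n * (Λ + Λ))             ≡⟨ e2 (D G H) n Λ ⟩
      n * 2 * Λ * D G H                 ∎)
      where
      e1 : ∀ n L N x → n * 2 * L * (N * x) ≡ n * (2 * x) * (N * L)
      e1 = solve-∀
      e2 : ∀ d n L → d * (n * (L + L)) ≡ n * 2 * L * d
      e2 = solve-∀
    -- D H ≤ N² means that N is at least the average degree of H, which exceeds t by the choice of
    -- `boundary`.
    t≤N : t ≤ N
    t≤N = begin
      t                ≤⟨ m≤m+n t (κ * (ℓ + ℓ)) ⟩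
      t + κ * (ℓ + ℓ)  ≤⟨ ≤-trans (m≤n+m _ (ℓ + κ * (ℓ + ℓ))) (m≤n+m _ (suc (8 * ℓ))) ⟩
      b                ≤⟨ m≤n*m b Λ {{>-nonZero 0<Λ}} ⟩
      Λ * b            ≤⟨ m≤n*m (Λ * b) 8 ⟩
      8 * (Λ * b)      ≤⟨ *-cancelˡ-≤ N {{>-nonZero 0<H}} (≤-trans dense-H (D≤∣∣² G H)) ⟩
      N                ∎
    chosen = choose t H t≤N
    branch = proj₁ chosen
    links : ∀ W F → length W ≤ t + κ * (ℓ + ℓ) → length F ≤ κ * (ℓ + ℓ) → ∀ i j → i ≢ j → Link c (branch i) (branch j) W F (ℓ + ℓ)
    links W F lW lF i j i≢j =
      connect c proper {T = T} (B.schedule den smaller) B.inv-start ≤-refl (s≤s z≤n) bounded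
        (proj₁ (proj₂ chosen) i) (proj₁ (proj₂ chosen) j) (λ q → i≢j (proj₂ (proj₂ chosen) q))
      where
      smaller : N * (8 * (Λ * (suc (8 * ℓ) + (ℓ + length F + length W)))) ≤ D G H
      smaller = ≤-trans (*-monoʳ-≤ N (*-monoʳ-≤ 8 (*-monoʳ-≤ Λ (+-monoʳ-≤ (suc (8 * ℓ)) (+-mono-≤ (+-monoʳ-≤ ℓ lF) lW))))) dense-H

-- 48 = 2 · 8 · 3 uses `lev n` ≤ 3 log n; 24 comes from ℓ ≤ 24 log n (log log n + 4); the bracket
-- collects the 9 + 4κ multiples of ℓ in `boundary` and the remaining 1 + t, where κ is the number
-- of pairs.
threshold : ℕ → ℕ
threshold t = 48 * (24 * (10 + 4 * length (pairs t) + t))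

degree-bound : ∀ t n → 0 < n → 0 < ⌊log₂ n ⌋ →
  2 * (8 * (lev n * boundary t (pathBound (lev n)))) ≤
  ⌊log₂ n ⌋ * ⌊log₂ n ⌋ * (threshold t * (⌊log₂ ⌊log₂ n ⌋ ⌋ + 4))
degree-bound t n 0<n 0<l = begin
  2 * (8 * (Λ * boundary t ℓ))          ≤⟨ *-monoʳ-≤ 2 (*-monoʳ-≤ 8 (*-mono-≤ Λ≤3l b≤)) ⟩
  2 * (8 * (3 * l * (a * (24 * (l * h))))) ≡⟨ e1 l a h ⟩
  l * l * (48 * (24 * a) * h)           ∎
  where
  open ≤-Reasoning
  l = ⌊log₂ n ⌋
  Λ = lev n
  ℓ = pathBound Λ
  μ = ⌊log₂ l ⌋
  h = μ + 4
  κ = length (pairs t)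
  a = 10 + 4 * κ + t
  e1 : ∀ l a h → 2 * (8 * (3 * l * (a * (24 * (l * h))))) ≡ l * l * (48 * (24 * a) * h)
  e1 = solve-∀
  Λ≤3l : Λ ≤ 3 * l
  Λ≤3l = ≤-trans (lev≤ n 0<n) (≤-trans (+-monoʳ-≤ (2 * l) 0<l) (≤-reflexive (e l)))
    where
    e : ∀ l → 2 * l + l ≡ 3 * l
    e = solve-∀
  ℓ≤ : ℓ ≤ 24 * (l * h)
  ℓ≤ with Λ in eqΛ
  ... | zero = z≤n
  ... | suc Λ′ = begin
    harmonic (8 * suc Λ′) (suc Λ′)                      ≤⟨ harmonic≤ (8 * suc Λ′) (suc Λ′) (s≤s z≤n) ⟩
    suc ⌊log₂ suc Λ′ ⌋ * (8 * suc Λ′) + 2 * suc Λ′      ≤⟨ +-mono-≤ (*-monoˡ-≤ (8 * suc Λ′) logΛ) (*-monoˡ-≤ (suc Λ′) (m≤m+n 2 6)) ⟩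
    (3 + μ) * (8 * suc Λ′) + 8 * suc Λ′                 ≡⟨ e μ (suc Λ′) ⟩
    8 * h * suc Λ′                                      ≤⟨ *-monoʳ-≤ (8 * h) (subst (_≤ 3 * l) eqΛ Λ≤3l) ⟩
    8 * h * (3 * l)                                     ≡⟨ e′ h l ⟩
    24 * (l * h)                                        ∎
    where
    e : ∀ μ L → (3 + μ) * (8 * L) + 8 * L ≡ 8 * (μ + 4) * L
    e = solve-∀
    e′ : ∀ h l → 8 * h * (3 * l) ≡ 24 * (l * h)
    e′ = solve-∀
    e″ : ∀ x → 4 * (2 * x) ≡ 2 * (2 * (2 * x))
    e″ = solve-∀
    logΛ : ⌊log₂ suc Λ′ ⌋ < 3 + μ
    logΛ = m<2^k⇒log₂m<k (s≤s z≤n) (begin-strict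
      suc Λ′                ≤⟨ subst (_≤ 3 * l) eqΛ Λ≤3l ⟩
      3 * l                 ≤⟨ *-monoˡ-≤ l (m≤m+n 3 1) ⟩
      4 * l                 <⟨ *-monoʳ-< 4 (proj₂ (log₂-bounds l 0<l)) ⟩
      4 * (2 * 2 ^ μ)       ≡⟨ e″ (2 ^ μ) ⟩
      2 ^ (3 + μ)           ∎)
  1≤lh : 1 ≤ 24 * (l * h)
  1≤lh = ≤-trans (*-mono-≤ 0<l (≤-trans (s≤s z≤n) (m≤n+m 4 μ))) (m≤n*m (l * h) 24)
  b≤ : boundary t ℓ ≤ a * (24 * (l * h))
  b≤ = begin
    suc (8 * ℓ) + (ℓ + κ * (ℓ + ℓ) + (t + κ * (ℓ + ℓ)))  ≡⟨ e ℓ κ t ⟩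
    (9 + 4 * κ) * ℓ + (1 + t) * 1                        ≤⟨ +-mono-≤ (*-monoʳ-≤ (9 + 4 * κ) ℓ≤) (*-monoʳ-≤ (1 + t) 1≤lh) ⟩
    (9 + 4 * κ) * z + (1 + t) * z                        ≡⟨ e′ κ t z ⟩
    a * z                                                ∎
    where
    z = 24 * (l * h)
    e : ∀ l k t → suc (8 * l) + (l + k * (l + l) + (t + k * (l + l))) ≡ (9 + 4 * k) * l + (1 + t) * 1
    e = solve-∀
    e′ : ∀ k t z → (9 + 4 * k) * z + (1 + t) * z ≡ (10 + 4 * k + t) * z
    e′ = solve-∀

theorem1p1 : ∀ (t : ℕ) → 0 < t → ∀ (p q : ℕ) → 0 < p → 0 < q →
    ∃[ n₀ ] ∀ (n : ℕ) → n₀ ≤ n → (G : SimpleGraph n) → (c : EdgeColouring G) →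
    Proper c → AvgDegAtLeastLogPow G p q → RainbowTK G c t
theorem1p1 t 0<t p q 0<p 0<q = 2 ^ (2 ^ m₀) , λ n n₀≤n G c proper avg →
    dense⇒rainbowTK t G c proper (0<n n₀≤n) (0<Λ n₀≤n) (≮⇒≥ (sparse-impossible n₀≤n G avg))
  where
  C = threshold t
  -- The bound required by `linear^≤2^`; the double exponential n₀ ensures log log n ≥ m₀.
  m₀ = 3 * (C * (4 + q)) * q
  module _ {n : ℕ} (n₀≤n : 2 ^ (2 ^ m₀) ≤ n) where
    open ≤-Reasoning
    l = ⌊log₂ n ⌋
    μ = ⌊log₂ l ⌋
    2^m₀≤l : 2 ^ m₀ ≤ l
    2^m₀≤l = 2^k≤m⇒k≤log₂m n₀≤n
    0<l : 0 < l
    0<l = ≤-trans (m^n>0 2 m₀) 2^m₀≤l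
    0<n : 0 < n
    0<n = ≤-trans (m^n>0 2 (2 ^ m₀)) n₀≤n
    2≤n : 2 ≤ n
    2≤n = ≤-trans (^-monoʳ-≤ 2 {1} (m^n>0 2 m₀)) n₀≤n
    0<Λ : 0 < lev n
    0<Λ = 2^k≤m⇒k≤log₂m {1} (≤-trans 2≤n (m≤m*n n n {{>-nonZero 0<n}}))
    instance
      q≢0 : NonZero q
      q≢0 = >-nonZero 0<q
    needed = 2 * (8 * (lev n * boundary t (pathBound (lev n))))
    needed^q≤ : needed ^ q ≤ l ^ (2 * q + p)
    needed^q≤ = begin
      needed ^ q                                  ≤⟨ ^-monoˡ-≤ q (degree-bound t n 0<n 0<l) ⟩
      (l * l * (C * (μ + 4))) ^ q            ≡⟨ ^-distribʳ-* q (l * l) _ ⟩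
      (l * l) ^ q * (C * (μ + 4)) ^ q        ≤⟨ *-monoʳ-≤ ((l * l) ^ q) (linear^≤2^ C q μ (2^k≤m⇒k≤log₂m 2^m₀≤l)) ⟩
      -- The q-th power of the double-logarithmic factor has shrunk to at most one factor l, which p
      -- ≥ 1 supplies.
      (l * l) ^ q * 2 ^ μ                    ≤⟨ *-mono-≤ (≤-reflexive sq) (proj₁ (log₂-bounds l 0<l)) ⟩
      l ^ (2 * q) * l                        ≤⟨ *-monoʳ-≤ (l ^ (2 * q)) (≤-trans (≤-reflexive (≡-sym (*-identityʳ l))) (^-monoʳ-≤ l {{>-nonZero 0<l}} 0<p)) ⟩
      l ^ (2 * q) * l ^ p                    ≡⟨ ≡-sym (^-distribˡ-+-* l (2 * q) p) ⟩
      l ^ (2 * q + p)                        ∎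
      where
      sq : (l * l) ^ q ≡ l ^ (2 * q)
      sq = trans (cong (λ z → (l * z) ^ q) (≡-sym (*-identityʳ l))) (^-*-assoc l 2 q)
    -- The degree hypothesis is tested at the single rational u / v = l / 1. Too small a degree
    -- would give n < 2^l, against l being the integer part of log n.
    sparse-impossible : (G : SimpleGraph n) → AvgDegAtLeastLogPow G p q → ¬ (degSum G < n * needed)
    sparse-impossible G avg lt = <⇒≱ (avg l 1 (s≤s z≤n) (begin-strict
        1 ^ (2 * q + p) * degSum G ^ q   ≡⟨ trans (cong (_* degSum G ^ q) (^-zeroˡ (2 * q + p))) (*-identityˡ _) ⟩
        degSum G ^ q                     <⟨ ^-monoˡ-< q lt ⟩
        (n * needed) ^ q                      ≡⟨ ^-distribʳ-* q n needed ⟩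
        n ^ q * needed ^ q                    ≤⟨ *-monoʳ-≤ (n ^ q) needed^q≤ ⟩
        n ^ q * l ^ (2 * q + p)          ≡⟨ *-comm (n ^ q) _ ⟩
        l ^ (2 * q + p) * n ^ q          ∎))
      (≤-trans (proj₁ (log₂-bounds n 0<n)) (≤-reflexive (≡-sym (*-identityʳ n))))
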